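{- Let $q>8$ be a power of $2$. Assume that there exists a complete $k$-arc in $PG(2,q)$ with $k<q-5$. Then there exists a complete $n$-cap in $PG(N,q)$ with $$n=\begin{cases} k\,q^{\frac{N-2}{2}}+3\sum_{j=1}^{(N-2)/2} q^{j}-N+3, & N\geq 4 \text{ even},\\[2mm] \left(2+\frac{k}{q}\right)q^{\frac{N-1}{2}}+3\sum_{j=1}^{(N-3)/2} q^{j}-N+4, & N\geq 5 \text{ odd}.\end{cases}$$
   Context: A cap in the projective space $PG(N,q)$ over $\mathbb{F}_q$ is a set of points no three of which are collinear; a $k$-cap is a cap with $k$ points. A cap is complete if it is not contained in a larger cap. A cap in $PG(2,q)$ is called an arc ($k$-arc if it has $k$ points). In the paper the even case is printed as $\frac{k}{q}q^{N/2}+3(q^{\frac{N-2}{2}}+\dots+q)-N+3$ and the odd case as $(2+\frac{k}{q})q^{\frac{N-1}{2}}+3(q^{\frac{N-3}{2}}+\dots+q)-N+4$; the sums above are exactly these (empty sum $=0$). -}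

module Defs where

open import Level using (0ℓ)
open import Algebra.Bundles using (CommutativeRing)
open import Data.Nat as ℕ using (ℕ; suc; _^_)
open import Data.Fin using (Fin)
open import Data.Product using (Σ; ∃; _×_; _,_)
open import Data.Vec.Functional using (_∷_)
open import Relation.Nullary using (¬_)
open import Relation.Binary.PropositionalEquality using (_≡_; _≢_)

record IsFiniteField (F : CommutativeRing 0ℓ 0ℓ) (q : ℕ) : Set where
  open CommutativeRing F
  field
    1≉0      : ¬ (1# ≈ 0#)
    inverse  : ∀ x → ¬ (x ≈ 0#) → ∃ λ y → (x * y) ≈ 1#
    enum     : Fin q → Carrier
    enum-inj : ∀ i j → enum i ≈ enum j → i ≡ j
    enum-sur : ∀ x → ∃ λ i → enum i ≈ x

IsPowerOf2 : ℕ → Set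
IsPowerOf2 q = ∃ λ h → q ≡ 2 ^ h

module Projective (F : CommutativeRing 0ℓ 0ℓ) where
  open CommutativeRing F

  -- Homogeneous coordinate vectors of PG(N,F): vectors in F^(N+1).
  -- A point of PG(N,F) is represented by a nonzero vector; two nonzero
  -- vectors represent the same point iff they are linearly dependent.
  Vect : ℕ → Set
  Vect N = Fin (suc N) → Carrier

  IsZero : ∀ {N} → Vect N → Set
  IsZero u = ∀ t → u t ≈ 0#

  -- u, v linearly dependent (same projective point, if both nonzero)
  Dep2 : ∀ {N} → Vect N → Vect N → Set
  Dep2 u v = Σ Carrier λ a → Σ Carrier λ b →
    ¬ (a ≈ 0# × b ≈ 0#) × (∀ t → ((a * u t) + (b * v t)) ≈ 0#)

  -- u, v, w linearly dependent (collinear points, if pairwise distinct)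
  Dep3 : ∀ {N} → Vect N → Vect N → Vect N → Set
  Dep3 u v w = Σ Carrier λ a → Σ Carrier λ b → Σ Carrier λ c →
    ¬ (a ≈ 0# × b ≈ 0# × c ≈ 0#) ×
    (∀ t → ((a * u t) + (b * v t) + (c * w t)) ≈ 0#)

  IsCap : ∀ N n → (Fin n → Vect N) → Set
  IsCap N n P =
    (∀ i → ¬ IsZero (P i)) ×
    (∀ i j → i ≢ j → ¬ Dep2 (P i) (P j)) ×
    (∀ i j l → i ≢ j → j ≢ l → i ≢ l → ¬ Dep3 (P i) (P j) (P l))

  IsCompleteCap : ∀ N n → (Fin n → Vect N) → Set
  IsCompleteCap N n P = IsCap N n P × (∀ v → ¬ IsCap N (suc n) (v ∷ P))

  HasCompleteCap : ∀ N n → Set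
  HasCompleteCap N n = Σ (Fin n → Vect N) (IsCompleteCap N n)

sumPow : ℕ → ℕ → ℕ
sumPow q ℕ.zero = 0
sumPow q (suc m) = sumPow q m ℕ.+ q ^ suc m

{-# OPTIONS --safe #-}
module Submission where

open import Defs
open import Level using (0ℓ)
open import Algebra.Bundles using (CommutativeRing; RawRing)
open import Data.Bool using (Bool; true; false; _xor_; _∧_)
open import Data.Empty using (⊥; ⊥-elim)
open import Data.Fin using (Fin; zero; suc; punchOut; punchIn; splitAt; join; remQuot; combine; _↑ˡ_; _↑ʳ_)
open import Data.Fin.Patterns using (0F; 1F; 2F; 3F)
import Data.Fin.Properties as Fin
open import Data.Maybe using (just; nothing)
open import Data.Nat as ℕ using (ℕ; zero; suc; _^_; _≤_; _<_; _∸_; _/_; _%_; s≤s; z≤n)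
open import Data.Nat.DivMod using (m≡m%n+[m/n]*n; m*n/n≡m)
import Data.Nat.Properties as ℕₚ
open import Data.Nat.Solver using (module +-*-Solver)
open import Data.Product using (Σ; ∃; _×_; _,_; proj₁; proj₂)
open import Data.Product.Relation.Binary.Pointwise.NonDependent using (_×ₛ_)
open import Data.Sum using (_⊎_; inj₁; inj₂; [_,_]; [_,_]′)
open import Data.Unit using (⊤; tt)
import Data.Vec.Functional as Vector
open import Data.Vec.Functional.Relation.Binary.Equality.Setoid using (≋-setoid)
open import Function using (_∘_; id)
open import Relation.Binary.Bundles using (Setoid)
open import Relation.Binary.Definitions using (WeaklyDecidable)
open import Relation.Binary.PropositionalEquality as ≡ using (_≡_; _≢_)
open import Relation.Nullary using (¬_; Dec; yes; no; contradiction)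
open import Relation.Nullary.Decidable using (map′; ¬?)

-- Split the coordinates into blocks (x,y) of F² and let Par be the set of vectors with y = x² in every block.
-- In characteristic 2, if α, β, α + β are nonzero, then every vector is α p + β r for unique p, r ∈ Par, because
-- x² + α y = β (α + β) r². Hence K × Par covers all affine points when K is the complete arc, viewed in the affine
-- plane whose line at infinity is external to it.
--
-- At infinity K × Par covers only its chord directions. The remaining points are covered by layers
-- {(w,p) : w ∈ {(1,0), (0,1), (1,c)}, p ∈ Par \ 0}, one for each leading block, where c ∉ {0, 1} and c² + c + 1 ≠ 0:
-- a leading block ω ≠ 0 is a combination of two of the w in several ways, and for a given nonzero tail one of them
-- avoids p = 0 and r = 0. Three points over distinct w are never collinear, since p + c r + s = 0 on Par forces r = 0.
-- A counting argument moves K affinely so that no w is a difference of two points of K and K misses the parabola.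
--
-- For N even the cap is K × Par with the layers at infinity; for N odd it consists of Par over the leading blocks
-- (1,0) and (0,1), of K × Par over (1,1), and of the same layers.

-- The construction rests on `Par` being closed under addition, though not under scaling. Its chord
-- directions are therefore exactly the scalar multiples of its own vectors, so the layers at
-- infinity must avoid these multiples and cover everything else; below a zero block the same task
-- recurs with one block fewer, which gives the recursion of `Lower`. The topmost layer `Upper`
-- differs because the block of K takes part in the chords: (ω, 0) is already a chord direction
-- there, whereas (w, p) with p nonzero must not be one, hence the demand on differences of K. The
-- condition c² + c + 1 ≠ 0 comes from coverage: an ω that is no multiple of a w is a combination of
-- two of them in three ways, and the condition excludes the case in which all three fail for the
-- same tail. Completeness of the given arc is a negative statement, so K covers points only up to
-- double negation; completeness of the new cap is negative as well, so this is enough.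

injective⇒surjective : ∀ {n} (f : Fin n → Fin n) → (∀ {i j} → f i ≡ f j → i ≡ j) →
                       ∀ j → ∃ λ i → f i ≡ j
injective⇒surjective {suc n} f inj j with Fin.any? (λ i → f i Fin.≟ j)
... | yes found = found
... | no ∄i = contradiction (Fin.injective⇒≤ {f = λ i → punchOut (miss i)}
                               (inj ∘ Fin.punchOut-injective (miss _) (miss _)))
                             ℕₚ.1+n≰n
  where
  miss : ∀ i → j ≢ f i
  miss i eq = ∄i (i , ≡.sym eq)

-- Finite fields: decidable equality, inverses, characteristic

module FiniteField (F : CommutativeRing 0ℓ 0ℓ) (q : ℕ) (ff : IsFiniteField F q) where
  open CommutativeRing F hiding (zero)
  open IsFiniteField ff
  open import Relation.Binary.Reasoning.Setoid setoid
  open import Algebra.Properties.CommutativeMonoid.Sum +-commutativeMonoid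
  open import Algebra.Properties.Semiring.Mult semiring using (×1-homo-*) renaming (_×_ to _·_)
  open import Algebra.Properties.Ring ring using (+-cancelˡ)
  open import Data.Fin.Permutation using (permutation)

  index : Carrier → Fin q
  index x = proj₁ (enum-sur x)

  enum-index : ∀ x → enum (index x) ≈ x
  enum-index x = proj₂ (enum-sur x)

  index-cong : ∀ {x y} → x ≈ y → index x ≡ index y
  index-cong x≈y = enum-inj _ _ (trans (enum-index _) (trans x≈y (sym (enum-index _))))

  infix 4 _≟_
  _≟_ : ∀ x y → Dec (x ≈ y)
  x ≟ y = map′ (λ eq → trans (sym (enum-index x)) (trans (reflexive (≡.cong enum eq)) (enum-index y)))
               index-cong (index x Fin.≟ index y)

  inv : Carrier → Carrier
  inv x with x ≟ 0#
  ... | yes _ = 0#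
  ... | no x≉0 = proj₁ (inverse x x≉0)

  invʳ : ∀ {x} → ¬ x ≈ 0# → x * inv x ≈ 1#
  invʳ {x} x≉0 with x ≟ 0#
  ... | yes x≈0 = contradiction x≈0 x≉0
  ... | no x≉0′ = proj₂ (inverse x x≉0′)

  *-≈0 : ∀ {x y} → ¬ x ≈ 0# → x * y ≈ 0# → y ≈ 0#
  *-≈0 {x} {y} x≉0 xy≈0 = begin
    y               ≈⟨ *-identityˡ y ⟨
    1# * y          ≈⟨ *-congʳ (trans (*-comm _ _) (invʳ x≉0)) ⟨
    (inv x * x) * y ≈⟨ *-assoc _ _ _ ⟩
    inv x * (x * y) ≈⟨ *-congˡ xy≈0 ⟩
    inv x * 0#      ≈⟨ zeroʳ _ ⟩
    0#              ∎

  *-≉0 : ∀ {x y} → ¬ x ≈ 0# → ¬ y ≈ 0# → ¬ x * y ≈ 0#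
  *-≉0 x≉0 y≉0 = y≉0 ∘ *-≈0 x≉0

  inv-≉0 : ∀ {x} → ¬ x ≈ 0# → ¬ inv x ≈ 0#
  inv-≉0 x≉0 eq = 1≉0 (trans (sym (invʳ x≉0)) (trans (*-congˡ eq) (zeroʳ _)))

  sq-≈0 : ∀ {x} → x * x ≈ 0# → x ≈ 0#
  sq-≈0 {x} eq with x ≟ 0#
  ... | yes x≈0 = x≈0
  ... | no x≉0 = *-≈0 x≉0 eq

  -- Translation by 1 permutes F, so the sum over F is unchanged when q · 1 is added.
  q·1≈0 : q · 1# ≈ 0#
  q·1≈0 = +-cancelˡ (sum enum) (q · 1#) 0# (begin
      sum enum + q · 1#                     ≈⟨ +-congˡ (sum-replicate q) ⟨
      sum enum + sum {q} (λ _ → 1#)         ≈⟨ ∑-distrib-+ enum (λ _ → 1#) ⟨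
      sum (λ i → enum i + 1#)               ≈⟨ sum-cong-≋ {q} (λ i → enum-index (enum i + 1#)) ⟨
      sum (λ i → enum (index (enum i + 1#))) ≈⟨ sum-permute enum π ⟨
      sum enum                              ≈⟨ +-identityʳ _ ⟨
      sum enum + 0#                         ∎)
    where
    shift-back : ∀ {a b} → a + b ≈ 0# → ∀ i → index (enum (index (enum i + a)) + b) ≡ i
    shift-back {a} {b} ab i = enum-inj _ _ (begin
      enum (index (enum (index (enum i + a)) + b)) ≈⟨ enum-index _ ⟩
      enum (index (enum i + a)) + b                ≈⟨ +-congʳ (enum-index _) ⟩
      enum i + a + b                               ≈⟨ +-assoc _ _ _ ⟩
      enum i + (a + b)                             ≈⟨ +-congˡ ab ⟩
      enum i + 0#                                  ≈⟨ +-identityʳ _ ⟩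
      enum i                                       ∎)
    π = permutation (λ i → index (enum i + 1#)) (λ i → index (enum i + - 1#))
          (shift-back (-‿inverseˡ 1#)) (shift-back (-‿inverseʳ 1#))

  -- Were 2 nonzero in F, every power of 2 would be, against `q·1≈0` for q = 2^h.
  1+1≈0 : IsPowerOf2 q → 1# + 1# ≈ 0#
  1+1≈0 (h , q≡2^h) with 1# + 1# ≟ 0#
  ... | yes eq = eq
  ... | no 2≉0 = contradiction (trans (reflexive (≡.cong (_· 1#) (≡.sym q≡2^h))) q·1≈0) (2^h≉0 h)
    where
    2^h≉0 : ∀ h → ¬ (2 ^ h) · 1# ≈ 0#
    2^h≉0 zero eq = 1≉0 (trans (sym (+-identityʳ _)) eq)
    2^h≉0 (suc h) eq = *-≉0 2≉0 (2^h≉0 h) (begin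
      (1# + 1#) * ((2 ^ h) · 1#)       ≈⟨ *-congʳ (+-congˡ (+-identityʳ 1#)) ⟨
      (2 · 1#) * ((2 ^ h) · 1#)        ≈⟨ ×1-homo-* 2 (2 ^ h) ⟨
      (2 ℕ.* 2 ^ h) · 1#               ≈⟨ eq ⟩
      0#                               ∎)

-- Characteristic 2: a ring solver over GF(2), square roots

module Char2 (F : CommutativeRing 0ℓ 0ℓ) (q : ℕ) (ff : IsFiniteField F q) (pow : IsPowerOf2 q) where
  open CommutativeRing F hiding (zero)
  open IsFiniteField ff
  open FiniteField F q ff public
  open import Algebra.Solver.Ring.AlmostCommutativeRing using (fromCommutativeRing; _-Raw-AlmostCommutative⟶_; Induced-equivalence)
  open import Relation.Binary.Reasoning.Setoid setoid

  x+x≈0 : ∀ x → x + x ≈ 0#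
  x+x≈0 x = begin
    x + x             ≈⟨ +-cong (*-identityʳ x) (*-identityʳ x) ⟨
    x * 1# + x * 1#   ≈⟨ distribˡ x 1# 1# ⟨
    x * (1# + 1#)     ≈⟨ *-congˡ (1+1≈0 pow) ⟩
    x * 0#            ≈⟨ zeroʳ x ⟩
    0#                ∎

  -- Coefficients in GF(2) let the ring solver decide identities of characteristic 2.
  private
    GF2 : RawRing 0ℓ 0ℓ
    GF2 = record { Carrier = Bool ; _≈_ = _≡_ ; _+_ = _xor_ ; _*_ = _∧_ ; -_ = id ; 0# = false ; 1# = true }

    GF2⟶F : GF2 -Raw-AlmostCommutative⟶ fromCommutativeRing F
    GF2⟶F = record
      { ⟦_⟧ = ⟦_⟧
      ; +-homo = λ { false y → sym (+-identityˡ _) ; true false → sym (+-identityʳ _) ; true true → sym (x+x≈0 1#) }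
      ; *-homo = λ { false y → sym (zeroˡ _) ; true y → sym (*-identityˡ _) }
      ; -‿homo = λ { false → sym -0#≈0# ; true → trans (sym (+-identityʳ 1#))
                       (trans (+-congˡ (sym (-‿inverseʳ 1#))) (trans (sym (+-assoc _ _ _))
                       (trans (+-congʳ (x+x≈0 1#)) (+-identityˡ _)))) }
      ; 0-homo = refl
      ; 1-homo = refl
      }
      where
      open import Algebra.Properties.Ring ring using (-0#≈0#)
      ⟦_⟧ : Bool → Carrier
      ⟦ false ⟧ = 0#
      ⟦ true ⟧ = 1#

    GF2-≟ : WeaklyDecidable (Induced-equivalence GF2⟶F)
    GF2-≟ false false = just refl
    GF2-≟ true true = just refl
    GF2-≟ _ _ = nothing

  open import Algebra.Solver.Ring GF2 (fromCommutativeRing F) GF2⟶F GF2-≟ public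
    using (solve; _:=_; _:+_; _:*_; con)

  ≈⇒+≈0 : ∀ {x y} → x ≈ y → x + y ≈ 0#
  ≈⇒+≈0 x≈y = trans (+-congʳ x≈y) (x+x≈0 _)

  +≈0⇒≈ : ∀ {x y} → x + y ≈ 0# → x ≈ y
  +≈0⇒≈ {x} {y} eq = begin
    x             ≈⟨ solve 2 (λ x y → x := (x :+ y) :+ y) refl x y ⟩
    (x + y) + y   ≈⟨ +-congʳ eq ⟩
    0# + y        ≈⟨ +-identityˡ y ⟩
    y             ∎

  *-cancelˡ : ∀ {x y z} → ¬ x ≈ 0# → x * y ≈ x * z → y ≈ z
  *-cancelˡ {x} {y} {z} x≉0 eq = +≈0⇒≈ (*-≈0 x≉0 (trans (distribˡ x y z) (≈⇒+≈0 eq)))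

  sq-injective : ∀ {x y} → x * x ≈ y * y → x ≈ y
  sq-injective {x} {y} eq = +≈0⇒≈ (sq-≈0 (begin
    (x + y) * (x + y)   ≈⟨ solve 2 (λ x y → (x :+ y) :* (x :+ y) := x :* x :+ y :* y) refl x y ⟩
    x * x + y * y       ≈⟨ ≈⇒+≈0 eq ⟩
    0#                  ∎))

  private
    -- Squaring is injective by `sq-injective` and F is finite, so every element is a square; the
    -- indices carry the argument to `Fin q`.
    square-root : ∀ x → ∃ λ i → index (enum i * enum i) ≡ index x
    square-root x = injective⇒surjective (λ i → index (enum i * enum i))
      (λ eq → enum-inj _ _ (sq-injective (trans (sym (enum-index _))
                (trans (reflexive (≡.cong enum eq)) (enum-index _))))) (index x)

  √ : Carrier → Carrier
  √ x = enum (proj₁ (square-root x))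

  √-sq : ∀ x → √ x * √ x ≈ x
  √-sq x = trans (sym (enum-index _)) (trans (reflexive (≡.cong enum (proj₂ (square-root x)))) (enum-index x))

-- Vectors of blocks, the parabola set, and the layer construction

module Levels (F : CommutativeRing 0ℓ 0ℓ) (q : ℕ) (ff : IsFiniteField F q) (pow : IsPowerOf2 q) where
  open CommutativeRing F hiding (zero)
  open IsFiniteField ff
  open Char2 F q ff pow
  open import Relation.Binary.Reasoning.Setoid setoid

  Block : Set
  Block = Fin 2 → Carrier

  V : ℕ → Set
  V n = Fin n → Block

  infix 4 _≈₂_ _≋_
  _≈₂_ : Block → Block → Set
  u ≈₂ v = ∀ t → u t ≈ v t

  _≋_ : ∀ {n} → V n → V n → Set
  u ≋ v = ∀ i → u i ≈₂ v i

  tail : ∀ {n} → V (suc n) → V n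
  tail v i = v (suc i)

  Zero₂ : Block → Set
  Zero₂ u = ∀ t → u t ≈ 0#

  Zero : ∀ {n} → V n → Set
  Zero v = ∀ i → Zero₂ (v i)

  Zero? : ∀ {n} (v : V n) → Dec (Zero v)
  Zero? v = Fin.all? λ i → Fin.all? λ t → v i t ≟ 0#

  R3 : (a b d x y z : Carrier) → Set
  R3 a b d x y z = a * x + b * y + d * z ≈ 0#

  swap₁₂ : ∀ {a b d x y z} → R3 a b d x y z → R3 b a d y x z
  swap₁₂ = trans (+-congʳ (+-comm _ _))

  swap₂₃ : ∀ {a b d x y z} → R3 a b d x y z → R3 a d b x z y
  swap₂₃ {a} {b} {d} {x} {y} {z} =
    trans (solve 3 (λ u v w → u :+ w :+ v := u :+ v :+ w) refl (a * x) (b * y) (d * z))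

  R3-cong : ∀ {a b d x y z x′ y′ z′} → x ≈ x′ → y ≈ y′ → z ≈ z′ → R3 a b d x y z → R3 a b d x′ y′ z′
  R3-cong xx yy zz h =
    trans (+-cong (+-cong (*-congˡ (sym xx)) (*-congˡ (sym yy))) (*-congˡ (sym zz))) h

  Rel : ∀ {n} (a b d : Carrier) (p r s : V n) → Set
  Rel a b d p r s = ∀ i t → R3 a b d (p i t) (r i t) (s i t)

  -- `no-line` carries no distinctness hypotheses: vectors of C related with nonzero coefficients
  -- must agree. This excludes proportional vectors too, since one of the two can be used twice with
  -- its coefficient split (`independent`).
  record Cap {n} (C : V n → Set) : Set where
    field
      nonzero : ∀ p → C p → ¬ Zero p
      no-line : ∀ p r s a b d → C p → C r → C s → ¬ a ≈ 0# → ¬ b ≈ 0# → ¬ d ≈ 0# → Rel a b d p r s → p ≋ r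

  -- The cap condition for vectors (w, p) over one fixed w: the leading block forces the
  -- coefficients to sum to zero.
  AffineCap : ∀ {n} → (V n → Set) → Set
  AffineCap A = ∀ p r s a b d → A p → A r → A s → ¬ a ≈ 0# → ¬ b ≈ 0# → ¬ d ≈ 0# →
                a + b + d ≈ 0# → Rel a b d p r s → p ≋ r

  -- Scalars may vanish and p may equal r, so the points of C themselves count as covered.
  Covers : ∀ {n} → (V n → Set) → V n → Set
  Covers C v = ∃ λ p → ∃ λ r → ∃ λ a → ∃ λ b → C p × C r × (∀ i t → v i t ≈ a * p i t + b * r i t)

  OnParabola : Block → Set
  OnParabola u = u 1F ≈ u 0F * u 0F

  Par : ∀ {n} → V n → Set
  Par v = ∀ i → OnParabola (v i)

  NzPar : ∀ {n} → V n → Set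
  NzPar v = Par v × ¬ Zero v

  Par-≋ : ∀ {n} {p r : V n} → Par p → Par r → (∀ i → p i 0F ≈ r i 0F) → p ≋ r
  Par-≋ pp pr h i 0F = h i
  Par-≋ pp pr h i 1F = trans (pp i) (trans (*-cong (h i) (h i)) (sym (pr i)))

  Par-zero : ∀ {n} {p : V n} → Par p → (∀ i → p i 0F ≈ 0#) → Zero p
  Par-zero pp h i 0F = h i
  Par-zero pp h i 1F = trans (pp i) (trans (*-congʳ (h i)) (zeroˡ _))

  -- Squaring is additive in characteristic 2. Hence the direction p + r of a chord of `Par` lies on
  -- `Par` again.
  Par-+ : ∀ {n} (p r : V n) → Par p → Par r → Par (λ i t → p i t + r i t)
  Par-+ p r pp pr i = trans (+-cong (pp i) (pr i))
    (solve 2 (λ x y → x :* x :+ y :* y := (x :+ y) :* (x :+ y)) refl (p i 0F) (r i 0F))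

  -- In each block a b (x + y)² = (a + b)(a x² + b y²) + (a x + b y)². The relation and a + b = d
  -- turn the right side into d · d z² + (d z)² = 0, so x = y.
  Par-affineCap : ∀ {n} → AffineCap (Par {n})
  Par-affineCap p r s a b d pp pr ps a≉0 b≉0 d≉0 sum≈0 rel = Par-≋ pp pr λ i → +≈0⇒≈
    (sq-≈0 (*-≈0 a≉0 (*-≈0 b≉0 (begin
      b * (a * ((p i 0F + r i 0F) * (p i 0F + r i 0F)))
        ≈⟨ solve 4 (λ a b x y → b :* (a :* ((x :+ y) :* (x :+ y))) :=
             (a :+ b) :* (a :* (x :* x) :+ b :* (y :* y)) :+ (a :* x :+ b :* y) :* (a :* x :+ b :* y))
             refl a b (p i 0F) (r i 0F) ⟩
      (a + b) * (a * (p i 0F * p i 0F) + b * (r i 0F * r i 0F)) + (a * p i 0F + b * r i 0F) * (a * p i 0F + b * r i 0F)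
        ≈⟨ +-cong (*-cong (+≈0⇒≈ sum≈0) (+≈0⇒≈ (R3-cong (pp i) (pr i) (ps i) (rel i 1F))))
                  (*-cong (+≈0⇒≈ (rel i 0F)) (+≈0⇒≈ (rel i 0F))) ⟩
      d * (d * (s i 0F * s i 0F)) + (d * s i 0F) * (d * s i 0F)
        ≈⟨ solve 2 (λ d z → d :* (d :* (z :* z)) :+ (d :* z) :* (d :* z) := con false) refl d (s i 0F) ⟩
      0# ∎))))

  -- x² = λ y in every block; for v = α p + β r with p, r on the parabolas this characterises
  -- p = 0 (λ = β) and r = 0 (λ = α).
  Q : ∀ {n} → Carrier → V n → Set
  Q l v = ∀ i → v i 0F * v i 0F ≈ l * v i 1F

  Q? : ∀ {n} l (v : V n) → Dec (Q l v)
  Q? l v = Fin.all? λ i → v i 0F * v i 0F ≟ l * v i 1F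

  -- The two conditions together give (l + m) y = 0 in every block, so l ≠ m leaves only the zero
  -- vector. A nonzero tail thus spoils at most one scalar.
  Q-unique : ∀ {n} {l m} {v : V n} → ¬ Zero v → Q l v → Q m v → l ≈ m
  Q-unique {l = l} {m} {v} v≢0 Ql Qm with l ≟ m
  ... | yes eq = eq
  ... | no l≉m = contradiction v≈0 v≢0
    where
    y≈0 : ∀ i → v i 1F ≈ 0#
    y≈0 i = *-≈0 (l≉m ∘ +≈0⇒≈) (trans (distribʳ _ _ _) (≈⇒+≈0 (trans (sym (Ql i)) (Qm i))))
    v≈0 : Zero v
    v≈0 i 0F = sq-≈0 (trans (Ql i) (trans (*-congˡ (y≈0 i)) (zeroʳ l)))
    v≈0 i 1F = y≈0 i

  record Decomposition {n} (α β : Carrier) (v : V n) : Set where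
    field
      p r   : V n
      par-p : Par p
      par-r : Par r
      eqn   : ∀ i t → v i t ≈ α * p i t + β * r i t
      p-zero : Zero p → Q β v
      r-zero : Zero r → Q α v

  -- With x = α p + β r and y = α p² + β r² in a block, x² + β y = α (α + β) p² and x² + α y = β (α
  -- + β) r². These can be solved for p² and r², and square roots exist.
  decompose : ∀ {n} α β → ¬ α ≈ 0# → ¬ β ≈ 0# → ¬ α ≈ β → (v : V n) → Decomposition α β v
  decompose α β α≉0 β≉0 α≉β v = record
    { p = λ i → on (√ (P i)) ; r = λ i → on (√ (R i))
    ; par-p = λ i → refl ; par-r = λ i → refl
    -- The first entry is compared after squaring, because only the squares of p and r are known
    -- explicitly.
    ; eqn = λ { i 0F → sq-injective (trans (x² i) (sym (sq-sum i))) ; i 1F → y i }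
    ; p-zero = λ z i → +≈0⇒≈ (*-≈0 δ≉0 (trans (sym (αP i)) (trans (*-congˡ (z i 1F)) (zeroʳ _))))
    ; r-zero = λ z i → +≈0⇒≈ (*-≈0 δ≉0 (trans (sym (βR i)) (trans (*-congˡ (z i 1F)) (zeroʳ _))))
    }
    where
    on : Carrier → Block
    on x 0F = x
    on x 1F = x * x
    δ = inv (α + β)
    δ≉0 : ¬ δ ≈ 0#
    δ≉0 = inv-≉0 (α≉β ∘ +≈0⇒≈)
    δʳ : (α + β) * δ ≈ 1#
    δʳ = invʳ (α≉β ∘ +≈0⇒≈)
    N : Carrier → Fin _ → Carrier
    N l i = v i 0F * v i 0F + l * v i 1F
    P R : Fin _ → Carrier
    P i = inv α * (δ * N β i)
    R i = inv β * (δ * N α i)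
    scaled : ∀ {l} z → ¬ l ≈ 0# → l * (√ (inv l * z) * √ (inv l * z)) ≈ z
    scaled {l} z l≉0 = begin
      l * (√ (inv l * z) * √ (inv l * z)) ≈⟨ *-congˡ (√-sq _) ⟩
      l * (inv l * z)                     ≈⟨ *-assoc _ _ _ ⟨
      l * inv l * z                       ≈⟨ *-congʳ (invʳ l≉0) ⟩
      1# * z                              ≈⟨ *-identityˡ z ⟩
      z                                   ∎
    αP : ∀ i → α * (√ (P i) * √ (P i)) ≈ δ * N β i
    αP i = scaled _ α≉0
    βR : ∀ i → β * (√ (R i) * √ (R i)) ≈ δ * N α i
    βR i = scaled _ β≉0
    y : ∀ i → v i 1F ≈ α * (√ (P i) * √ (P i)) + β * (√ (R i) * √ (R i))
    y i = begin
      v i 1F                      ≈⟨ *-identityˡ _ ⟨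
      1# * v i 1F                 ≈⟨ *-congʳ δʳ ⟨
      (α + β) * δ * v i 1F        ≈⟨ solve 5 (λ α β δ x y → (α :+ β) :* δ :* y :=
                                       δ :* (x :* x :+ β :* y) :+ δ :* (x :* x :+ α :* y))
                                       refl α β δ (v i 0F) (v i 1F) ⟩
      δ * N β i + δ * N α i       ≈⟨ +-cong (αP i) (βR i) ⟨
      _                           ∎
    x² : ∀ i → v i 0F * v i 0F ≈ α * (δ * N β i) + β * (δ * N α i)
    x² i = begin
      v i 0F * v i 0F                   ≈⟨ *-identityˡ _ ⟨
      1# * (v i 0F * v i 0F)            ≈⟨ *-congʳ δʳ ⟨
      (α + β) * δ * (v i 0F * v i 0F)   ≈⟨ solve 5 (λ α β δ x y → (α :+ β) :* δ :* (x :* x) :=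
                                       α :* (δ :* (x :* x :+ β :* y)) :+ β :* (δ :* (x :* x :+ α :* y)))
                                       refl α β δ (v i 0F) (v i 1F) ⟩
      _                                 ∎
    sq-sum : ∀ i → (α * √ (P i) + β * √ (R i)) * (α * √ (P i) + β * √ (R i)) ≈ α * (δ * N β i) + β * (δ * N α i)
    sq-sum i = trans (solve 4 (λ α β a b → (α :* a :+ β :* b) :* (α :* a :+ β :* b) :=
                 α :* (α :* (a :* a)) :+ β :* (β :* (b :* b))) refl α β (√ (P i)) (√ (R i)))
                 (+-cong (*-congˡ (αP i)) (*-congˡ (βR i)))

  -- The layers at infinity use a generic c; the outermost level uses c = 1, where the third block
  -- is (1,1).
  w : Carrier → Fin 3 → Block
  w c 0F 0F = 1#
  w c 0F 1F = 0#
  w c 1F 0F = 0#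
  w c 1F 1F = 1#
  w c 2F 0F = 1#
  w c 2F 1F = c

  w-nonzero : ∀ {c} i {a} → (∀ t → a * w c i t ≈ 0#) → a ≈ 0#
  w-nonzero 0F h = trans (sym (*-identityʳ _)) (h 0F)
  w-nonzero 1F h = trans (sym (*-identityʳ _)) (h 1F)
  w-nonzero 2F h = trans (sym (*-identityʳ _)) (h 0F)

  w-independent : ∀ {c} → ¬ c ≈ 0# → ∀ {i j a b} → i ≢ j → (∀ t → a * w c i t + b * w c j t ≈ 0#) → b ≈ 0#
  w-independent {c} c≉0 {i} {j} {a} {b} i≢j h = go i j i≢j h
    where
    second : ∀ {x y} → a * x + b * y ≈ 0# → x ≈ 0# → b * y ≈ 0#
    second eq x≈0 = trans (sym (trans (+-congʳ (trans (*-congˡ x≈0) (zeroʳ a))) (+-identityˡ _))) eq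
    first : ∀ {x y} → a * x + b * y ≈ 0# → y ≈ 0# → a * x ≈ 0#
    first eq y≈0 = trans (sym (trans (+-congˡ (trans (*-congˡ y≈0) (zeroʳ b))) (+-identityʳ _))) eq
    one : ∀ {x} → x * 1# ≈ 0# → x ≈ 0#
    one = trans (sym (*-identityʳ _))
    third : ∀ {x} → a * x + b * 1# ≈ 0# → a ≈ 0# → b ≈ 0#
    third eq a≈0 = one (trans (sym (trans (+-congʳ (trans (*-congʳ a≈0) (zeroˡ _))) (+-identityˡ _))) eq)
    go : ∀ i j → i ≢ j → (∀ t → a * w c i t + b * w c j t ≈ 0#) → b ≈ 0#
    go 0F 0F i≢j h = contradiction ≡.refl i≢j
    go 1F 1F i≢j h = contradiction ≡.refl i≢j
    go 2F 2F i≢j h = contradiction ≡.refl i≢j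
    go 0F 1F _ h = one (second (h 1F) refl)
    go 0F 2F _ h = *-≈0 c≉0 (trans (*-comm c b) (second (h 1F) refl))
    go 1F 0F _ h = one (second (h 0F) refl)
    go 1F 2F _ h = one (second (h 0F) refl)
    go 2F 0F _ h = third (h 0F) (*-≈0 c≉0 (trans (*-comm c a) (first (h 1F) refl)))
    go 2F 1F _ h = third (h 1F) (one (first (h 0F) refl))

  -- The pieces `A i` sit over the normalised blocks w. `down` lies in the subspace where the
  -- leading block vanishes, which contains the points at infinity of every piece.
  data Layer {n} (c : Carrier) (A : Fin 3 → V n → Set) (S : V n → Set) (v : V (suc n)) : Set where
    up   : ∀ i → v zero ≈₂ w c i → A i (tail v) → Layer c A S v
    down : Zero₂ (v zero) → S (tail v) → Layer c A S v

  module _ {n} {c : Carrier} (c≉0 : ¬ c ≈ 0#) {A : Fin 3 → V n → Set} {S : V n → Set}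
           (affine : ∀ i → AffineCap (A i)) (cap : Cap S)
           (directions : ∀ i p r s e → A i p → A i r → S s → ¬ (∀ j t → s j t ≈ e * (p j t + r j t)))
           (transversal : ∀ p r s → A 0F p → A 1F r → A 2F s → ¬ (∀ j t → p j t + c * r j t + s j t ≈ 0#))
           where

    private
      Heads : (a b d : Carrier) (i j l : Fin 3) → Set
      Heads a b d i j l = ∀ t → R3 a b d (w c i t) (w c j t) (w c l t)

      -- The relation a w₀ + b w₁ + d w₂ = 0 fixes the coefficients up to a factor, a = d and b = d
      -- c; hence the shape p + c r + s of the hypothesis `transversal`.
      transversal′ : ∀ p r s a b d → A 0F p → A 1F r → A 2F s → ¬ d ≈ 0# →
                     Heads a b d 0F 1F 2F → Rel a b d p r s → ⊥
      transversal′ p r s a b d Ap Ar As d≉0 heads rel = transversal p r s Ap Ar As λ j t →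
        *-≈0 d≉0 (begin
          d * (p j t + c * r j t + s j t)
            ≈⟨ solve 5 (λ d c x y z → d :* (x :+ c :* y :+ z) := d :* x :+ (d :* c) :* y :+ d :* z)
                 refl d c (p j t) (r j t) (s j t) ⟩
          d * p j t + (d * c) * r j t + d * s j t
            ≈⟨ +-congʳ (+-cong (*-congʳ a≈d) (*-congʳ b≈dc)) ⟨
          a * p j t + b * r j t + d * s j t
            ≈⟨ rel j t ⟩
          0# ∎)
        where
        a≈d : a ≈ d
        a≈d = +≈0⇒≈ (trans (solve 3 (λ a b d → a :+ d := a :* con true :+ b :* con false :+ d :* con true)
                refl a b d) (heads 0F))
        b≈dc : b ≈ d * c
        b≈dc = +≈0⇒≈ (trans (solve 4 (λ a b d c → b :+ d :* c := a :* con false :+ b :* con true :+ d :* c)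
                refl a b d c) (heads 1F))

      distinct : ∀ i j l p r s a b d → i ≢ j → j ≢ l → i ≢ l → A i p → A j r → A l s →
                 ¬ a ≈ 0# → ¬ b ≈ 0# → ¬ d ≈ 0# → Heads a b d i j l → Rel a b d p r s → ⊥
      distinct 0F 0F _ p r s a b d ij jl il = contradiction ≡.refl ij
      distinct 1F 1F _ p r s a b d ij jl il = contradiction ≡.refl ij
      distinct 2F 2F _ p r s a b d ij jl il = contradiction ≡.refl ij
      distinct 0F _ 0F p r s a b d ij jl il = contradiction ≡.refl il
      distinct 1F _ 1F p r s a b d ij jl il = contradiction ≡.refl il
      distinct 2F _ 2F p r s a b d ij jl il = contradiction ≡.refl il
      distinct _ 0F 0F p r s a b d ij jl il = contradiction ≡.refl jl
      distinct _ 1F 1F p r s a b d ij jl il = contradiction ≡.refl jl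
      distinct _ 2F 2F p r s a b d ij jl il = contradiction ≡.refl jl
      distinct 0F 1F 2F p r s a b d _ _ _ Ap Ar As a≉0 b≉0 d≉0 hd rel =
        transversal′ p r s a b d Ap Ar As d≉0 hd rel
      distinct 0F 2F 1F p r s a b d _ _ _ Ap Ar As a≉0 b≉0 d≉0 hd rel =
        transversal′ p s r a d b Ap As Ar b≉0 (λ t → swap₂₃ (hd t)) (λ j t → swap₂₃ (rel j t))
      distinct 1F 0F 2F p r s a b d _ _ _ Ap Ar As a≉0 b≉0 d≉0 hd rel =
        transversal′ r p s b a d Ar Ap As d≉0 (λ t → swap₁₂ (hd t)) (λ j t → swap₁₂ (rel j t))
      distinct 1F 2F 0F p r s a b d _ _ _ Ap Ar As a≉0 b≉0 d≉0 hd rel =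
        transversal′ s p r d a b As Ap Ar b≉0 (λ t → swap₁₂ (swap₂₃ (hd t))) (λ j t → swap₁₂ (swap₂₃ (rel j t)))
      distinct 2F 0F 1F p r s a b d _ _ _ Ap Ar As a≉0 b≉0 d≉0 hd rel =
        transversal′ r s p b d a Ar As Ap a≉0 (λ t → swap₂₃ (swap₁₂ (hd t))) (λ j t → swap₂₃ (swap₁₂ (rel j t)))
      distinct 2F 1F 0F p r s a b d _ _ _ Ap Ar As a≉0 b≉0 d≉0 hd rel =
        transversal′ s r p d b a As Ar Ap a≉0 (λ t → swap₁₂ (swap₂₃ (swap₁₂ (hd t))))
                                               (λ j t → swap₁₂ (swap₂₃ (swap₁₂ (rel j t))))

      merge : ∀ {a b d x z} → R3 a b d x x z → (a + b) * x + d * z ≈ 0#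
      merge = trans (+-congʳ (distribʳ _ _ _))

      three-up : ∀ i j l p r s a b d → A i p → A j r → A l s → ¬ a ≈ 0# → ¬ b ≈ 0# → ¬ d ≈ 0# →
                 Heads a b d i j l → Rel a b d p r s → i ≡ j × p ≋ r
      three-up i j l p r s a b d Ap Ar As a≉0 b≉0 d≉0 hd rel with i Fin.≟ j | j Fin.≟ l | i Fin.≟ l
      ... | yes ≡.refl | yes ≡.refl | _ = ≡.refl , affine i p r s a b d Ap Ar As a≉0 b≉0 d≉0
              (w-nonzero i λ t → trans (distribʳ _ _ _) (merge (hd t))) rel
      ... | yes ≡.refl | no i≢l | _ = contradiction (w-independent c≉0 i≢l λ t → merge (hd t)) d≉0
      ... | no i≢j | yes ≡.refl | _ =
              contradiction (w-independent c≉0 (i≢j ∘ ≡.sym) λ t → merge (swap₂₃ (swap₁₂ (hd t)))) a≉0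
      ... | no i≢j | no _ | yes ≡.refl = contradiction (w-independent c≉0 i≢j λ t → merge (swap₂₃ (hd t))) b≉0
      ... | no i≢j | no j≢l | no i≢l =
              ⊥-elim (distinct i j l p r s a b d i≢j j≢l i≢l Ap Ar As a≉0 b≉0 d≉0 hd rel)

      drop₃ : ∀ {a b d x y z} → z ≈ 0# → R3 a b d x y z → a * x + b * y ≈ 0#
      drop₃ z≈0 h = trans (sym (trans (+-congˡ (trans (*-congˡ z≈0) (zeroʳ _))) (+-identityʳ _))) h

      drop₂₃ : ∀ {a b d x y z} → y ≈ 0# → z ≈ 0# → R3 a b d x y z → a * x ≈ 0#
      drop₂₃ y≈0 z≈0 h = trans (sym (trans (+-congˡ (trans (*-congˡ y≈0) (zeroʳ _))) (+-identityʳ _))) (drop₃ z≈0 h)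

      two-up : ∀ i j p r s a b d → A i p → A j r → S s → ¬ b ≈ 0# → ¬ d ≈ 0# →
               (∀ t → a * w c i t + b * w c j t ≈ 0#) → Rel a b d p r s → ⊥
      two-up i j p r s a b d Ap Ar Ss b≉0 d≉0 hd rel with i Fin.≟ j
      ... | no i≢j = b≉0 (w-independent c≉0 i≢j hd)
      ... | yes ≡.refl = directions i p r s (inv d * a) Ap Ar Ss λ k t → begin
          s k t                                ≈⟨ *-identityˡ _ ⟨
          1# * s k t                           ≈⟨ *-congʳ (trans (*-comm _ _) (invʳ d≉0)) ⟨
          inv d * d * s k t                    ≈⟨ *-assoc _ _ _ ⟩
          inv d * (d * s k t)                  ≈⟨ *-congˡ (+≈0⇒≈ (rel k t)) ⟨
          inv d * (a * p k t + b * r k t)      ≈⟨ *-congˡ (+-congˡ (*-congʳ a≈b)) ⟨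
          inv d * (a * p k t + a * r k t)      ≈⟨ solve 4 (λ e a x y → e :* (a :* x :+ a :* y) := e :* a :* (x :+ y))
                                                    refl (inv d) a (p k t) (r k t) ⟩
          inv d * a * (p k t + r k t)          ∎
        where
        a≈b : a ≈ b
        a≈b = +≈0⇒≈ (w-nonzero i λ t → trans (distribʳ _ _ _) (hd t))

    -- Split by how many of the three vectors lie in `up`. Three over the same w is `affine`, three
    -- over different w is `transversal`, and two equal w with a third different contradicts
    -- independence. If exactly two are in `up`, they have the same w and equal coefficients, so the
    -- third is a multiple of their difference, against `directions`. A single one in `up` would
    -- make its coefficient vanish.
    layer-cap : Cap (Layer c A S)
    layer-cap = record { nonzero = nonzero ; no-line = no-line }
      where
      nonzero : ∀ p → Layer c A S p → ¬ Zero p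
      nonzero p (up i h _) z = 1≉0 (w-nonzero i λ t → trans (*-congˡ (trans (sym (h t)) (z zero t))) (zeroʳ _))
      nonzero p (down _ s) z = Cap.nonzero cap (tail p) s (z ∘ suc)
      no-line : ∀ p r s a b d → Layer c A S p → Layer c A S r → Layer c A S s →
                ¬ a ≈ 0# → ¬ b ≈ 0# → ¬ d ≈ 0# → Rel a b d p r s → p ≋ r
      no-line p r s a b d (up i hp Ap) (up j hr Ar) (up l hs As) a≉0 b≉0 d≉0 rel
        with three-up i j l (tail p) (tail r) (tail s) a b d Ap Ar As a≉0 b≉0 d≉0
               (λ t → R3-cong (hp t) (hr t) (hs t) (rel zero t)) (rel ∘ suc)
      ... | ≡.refl , eq = λ { zero t → trans (hp t) (sym (hr t)) ; (suc k) → eq k }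
      no-line p r s a b d (up i hp Ap) (up j hr Ar) (down hs Ss) a≉0 b≉0 d≉0 rel =
        ⊥-elim (two-up i j (tail p) (tail r) (tail s) a b d Ap Ar Ss b≉0 d≉0
          (λ t → drop₃ refl (R3-cong (hp t) (hr t) (hs t) (rel zero t))) (rel ∘ suc))
      no-line p r s a b d (up i hp Ap) (down hr Sr) (up l hs As) a≉0 b≉0 d≉0 rel =
        ⊥-elim (two-up i l (tail p) (tail s) (tail r) a d b Ap As Sr d≉0 b≉0
          (λ t → drop₃ refl (swap₂₃ (R3-cong (hp t) (hr t) (hs t) (rel zero t)))) (λ k t → swap₂₃ (rel (suc k) t)))
      no-line p r s a b d (down hp Sp) (up j hr Ar) (up l hs As) a≉0 b≉0 d≉0 rel =
        ⊥-elim (two-up j l (tail r) (tail s) (tail p) b d a Ar As Sp d≉0 a≉0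
          (λ t → drop₃ refl (swap₂₃ (swap₁₂ (R3-cong (hp t) (hr t) (hs t) (rel zero t)))))
          (λ k t → swap₂₃ (swap₁₂ (rel (suc k) t))))
      no-line p r s a b d (up i hp Ap) (down hr Sr) (down hs Ss) a≉0 b≉0 d≉0 rel =
        contradiction (w-nonzero i λ t → drop₂₃ refl refl (R3-cong (hp t) (hr t) (hs t) (rel zero t))) a≉0
      no-line p r s a b d (down hp Sp) (up j hr Ar) (down hs Ss) a≉0 b≉0 d≉0 rel =
        contradiction (w-nonzero j λ t → drop₂₃ refl refl (swap₁₂ (R3-cong (hp t) (hr t) (hs t) (rel zero t)))) b≉0
      no-line p r s a b d (down hp Sp) (down hr Sr) (up l hs As) a≉0 b≉0 d≉0 rel =
        contradiction (w-nonzero l λ t → drop₂₃ refl refl (swap₁₂ (swap₂₃ (R3-cong (hp t) (hr t) (hs t) (rel zero t))))) d≉0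
      no-line p r s a b d (down hp Sp) (down hr Sr) (down hs Ss) a≉0 b≉0 d≉0 rel =
        λ { zero t → trans (hp t) (sym (hr t))
          ; (suc k) → Cap.no-line cap (tail p) (tail r) (tail s) a b d Sp Sr Ss a≉0 b≉0 d≉0 (rel ∘ suc) k }

-- Counting predicates up to setoid equality

module _ (S : Setoid 0ℓ 0ℓ) where
  open Setoid S

  record Enumeration (C : Carrier → Set) (n : ℕ) : Set where
    field
      at        : Fin n → Carrier
      at-∈      : ∀ i → C (at i)
      injective : ∀ i j → at i ≈ at j → i ≡ j
      find      : ∀ {x} → C x → ∃ λ i → at i ≈ x

module _ {S : Setoid 0ℓ 0ℓ} where
  open Setoid S
  open Enumeration

  -- Pigeonhole: if every element were hit, choosing preimages would inject `Fin N` into `Fin n`.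
  avoid : ∀ {n N} → Enumeration S (λ _ → ⊤) N → (∀ x y → Dec (x ≈ y)) → n < N →
          (g : Fin n → Carrier) → ∃ λ x → ∀ i → ¬ g i ≈ x
  avoid {n} {N} E _≟_ n<N g with Fin.any? (λ k → Fin.all? λ i → ¬? (g i ≟ at E k))
  ... | yes (k , missed) = at E k , missed
  ... | no all-hit = contradiction
      (Fin.injective⇒≤ {f = proj₁ ∘ hit} λ {k} {l} eq → injective E k l
        (trans (sym (proj₂ (hit k))) (trans (reflexive (≡.cong g eq)) (proj₂ (hit l)))))
      (ℕₚ.<⇒≱ n<N)
    where
    hit : ∀ k → ∃ λ i → g i ≈ at E k
    hit k with Fin.any? (λ i → g i ≟ at E k)
    ... | yes p = p
    ... | no ∄i = contradiction (k , λ i eq → ∄i (i , eq)) all-hit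

  enum-∅ : ∀ {C} → (∀ x → ¬ C x) → Enumeration S C 0
  enum-∅ ∅ = record { at = λ () ; at-∈ = λ () ; injective = λ () ; find = λ c → contradiction c (∅ _) }

  enum-⊎ : ∀ {C D m n} → (∀ {x y} → C x → D y → ¬ x ≈ y) → Enumeration S C m → Enumeration S D n →
           Enumeration S (λ x → C x ⊎ D x) (m ℕ.+ n)
  enum-⊎ {C} {D} {m} {n} disjoint E G = record
    { at = at′ ∘ splitAt m
    ; at-∈ = λ i → ∈′ (splitAt m i)
    ; injective = λ i j eq → ≡.trans (≡.sym (Fin.join-splitAt m n i))
        (≡.trans (≡.cong (join m n) (inj′ (splitAt m i) (splitAt m j) eq)) (Fin.join-splitAt m n j))
    ; find = λ { (inj₁ c) → find′ (inj₁ (proj₁ (find E c))) (proj₂ (find E c))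
               ; (inj₂ d) → find′ (inj₂ (proj₁ (find G d))) (proj₂ (find G d)) }
    }
    where
    at′ : Fin m ⊎ Fin n → Carrier
    at′ = [ at E , at G ]
    ∈′ : ∀ k → C (at′ k) ⊎ D (at′ k)
    ∈′ (inj₁ i) = inj₁ (at-∈ E i)
    ∈′ (inj₂ j) = inj₂ (at-∈ G j)
    inj′ : ∀ k l → at′ k ≈ at′ l → k ≡ l
    inj′ (inj₁ i) (inj₁ j) eq = ≡.cong inj₁ (injective E i j eq)
    inj′ (inj₁ i) (inj₂ j) eq = contradiction eq (disjoint (at-∈ E i) (at-∈ G j))
    inj′ (inj₂ i) (inj₁ j) eq = contradiction (sym eq) (disjoint (at-∈ E j) (at-∈ G i))
    inj′ (inj₂ i) (inj₂ j) eq = ≡.cong inj₂ (injective G i j eq)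
    find′ : ∀ {x} k → at′ k ≈ x → ∃ λ i → at′ (splitAt m i) ≈ x
    find′ k eq = join m n k , trans (reflexive (≡.cong at′ (Fin.splitAt-join m n k))) eq

  -- The new size comes with an equation instead of as n ∸ 1, so that no truncated subtraction
  -- enters the counts.
  enum-remove : ∀ {C n x₀} → Enumeration S C n → C x₀ →
                ∃ λ n′ → n ≡ suc n′ × Enumeration S (λ x → C x × ¬ x ≈ x₀) n′
  enum-remove {n = zero} E c with () ← proj₁ (find E c)
  enum-remove {C} {suc n} {x₀} E c = n , ≡.refl , record
    { at = at E ∘ punchIn i₀
    ; at-∈ = λ i → at-∈ E _ , λ eq → Fin.punchInᵢ≢i i₀ i (injective E _ _ (trans eq (sym at-i₀)))
    ; injective = λ i j eq → Fin.punchIn-injective i₀ i j (injective E _ _ eq)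
    ; find = find′
    }
    where
    i₀ = proj₁ (find E c)
    at-i₀ = proj₂ (find E c)
    find′ : ∀ {x} → C x × ¬ x ≈ x₀ → ∃ λ i → at E (punchIn i₀ i) ≈ x
    find′ {x} (d , x≉x₀) = punchOut i₀≢i , trans (reflexive (≡.cong (at E) (Fin.punchIn-punchOut i₀≢i))) at-i
      where
      i = proj₁ (find E d)
      at-i = proj₂ (find E d)
      i₀≢i : i₀ ≢ i
      i₀≢i eq = x≉x₀ (trans (sym at-i) (trans (reflexive (≡.cong (at E) (≡.sym eq))) at-i₀))

module _ {S T : Setoid 0ℓ 0ℓ} where
  private
    module S = Setoid S
    module T = Setoid T
  open Enumeration

  enum-map : ∀ {C D n} (f : S.Carrier → T.Carrier) →
             (∀ {x y} → x S.≈ y → f x T.≈ f y) → (∀ {x y} → f x T.≈ f y → x S.≈ y) →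
             (∀ x → C x → D (f x)) → (∀ y → D y → ∃ λ x → C x × f x T.≈ y) →
             Enumeration S C n → Enumeration T D n
  enum-map {C} {D} f f-cong f-reflects f-∈ preimage E = record
    { at = f ∘ at E
    ; at-∈ = λ i → f-∈ _ (at-∈ E i)
    ; injective = λ i j eq → injective E i j (f-reflects eq)
    ; find = λ {y} d → let x , c , fx≈y = preimage y d
                           i , eq = find E c
                       in i , T.trans (f-cong eq) fx≈y
    }

  enum-× : ∀ {C D m n} → Enumeration S C m → Enumeration T D n →
           Enumeration (S ×ₛ T) (λ (x , y) → C x × D y) (m ℕ.* n)
  enum-× {m = m} {n} E G = record
    { at = at′ ∘ remQuot n
    ; at-∈ = λ i → at-∈ E _ , at-∈ G _
    ; injective = λ i j (eq₁ , eq₂) → ≡.trans (≡.sym (Fin.combine-remQuot {m} n i))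
        (≡.trans (≡.cong₂ combine (injective E _ _ eq₁) (injective G _ _ eq₂)) (Fin.combine-remQuot {m} n j))
    ; find = λ (c , d) → let i , eq₁ = find E c
                             j , eq₂ = find G d
                         in combine i j , Setoid.trans (S ×ₛ T)
                              (Setoid.reflexive (S ×ₛ T) (≡.cong at′ (Fin.remQuot-combine i j))) (eq₁ , eq₂)
    }
    where
    at′ : Fin m × Fin n → S.Carrier × T.Carrier
    at′ (i , j) = at E i , at G j

-- Covering by layers, and the caps at infinity

module Coverage (F : CommutativeRing 0ℓ 0ℓ) (q : ℕ) (ff : IsFiniteField F q) (pow : IsPowerOf2 q) (8<q : 8 < q) where
  open CommutativeRing F hiding (zero)
  open IsFiniteField ff
  open Char2 F q ff pow
  open Levels F q ff pow
  open import Relation.Binary.Reasoning.Setoid setoid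

  enum-F : Enumeration setoid (λ _ → ⊤) q
  enum-F = record { at = enum ; at-∈ = λ _ → tt ; injective = enum-inj ; find = λ {x} _ → enum-sur x }

  avoid₄ : ∀ a b d e → ∃ λ x → ¬ x ≈ a × ¬ x ≈ b × ¬ x ≈ d × ¬ x ≈ e
  avoid₄ a b d e = x , h 0F ∘ sym , h 1F ∘ sym , h 2F ∘ sym , h 3F ∘ sym
    where
    g : Fin 4 → Carrier
    g 0F = a
    g 1F = b
    g 2F = d
    g 3F = e
    avoided = avoid enum-F _≟_ (ℕₚ.≤-trans (ℕₚ.m≤m+n 5 4) 8<q) g
    x = proj₁ avoided
    h = proj₂ avoided

  -- If a is a root of c² + c + 1, the only other root is a + 1, so any b outside {0, 1, a, a + 1}
  -- serves instead.
  ∃-parameter : ∃ λ c → ¬ c ≈ 0# × ¬ c ≈ 1# × ¬ c * c + c + 1# ≈ 0#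
  ∃-parameter with avoid₄ 0# 1# 0# 1#
  ... | a , a≉0 , a≉1 , _ with a * a + a + 1# ≟ 0#
  ...   | no ok = a , a≉0 , a≉1 , ok
  ...   | yes eq with avoid₄ 0# 1# a (a + 1#)
  ...     | b , b≉0 , b≉1 , b≉a , b≉a+1 = b , b≉0 , b≉1 , λ eq′ →
              *-≉0 (b≉a ∘ +≈0⇒≈) (b≉a+1 ∘ +≈0⇒≈) (begin
                (b + a) * (b + (a + 1#))
                  ≈⟨ solve 2 (λ a b → (b :+ a) :* (b :+ (a :+ con true)) :=
                       (b :* b :+ b :+ con true) :+ (a :* a :+ a :+ con true)) refl a b ⟩
                (b * b + b + 1#) + (a * a + a + 1#)  ≈⟨ +-cong eq′ eq ⟩
                0# + 0#                              ≈⟨ +-identityˡ 0# ⟩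
                0#                                   ∎)

  cons : ∀ {n} → Block → V n → V (suc n)
  cons u v zero = u
  cons u v (suc i) = v i

  module Parameter (c : Carrier) (c≉0 : ¬ c ≈ 0#) (c≉1 : ¬ c ≈ 1#) (c²+c+1≉0 : ¬ c * c + c + 1# ≈ 0#) where

    1+c≉0 : ¬ 1# + c ≈ 0#
    1+c≉0 = c≉1 ∘ sym ∘ +≈0⇒≈

    -- One pair of scalars must serve head and tail at once. The head limits the possible scalars;
    -- `decompose` then yields the tail vectors, which must be nonzero to be available over every w.
    record PairCover {n} (ω : Block) (v : V n) : Set where
      field
        i j  : Fin 3
        a b  : Carrier
        p r  : V n
        nz-p : NzPar p
        nz-r : NzPar r
        head-eqn : ∀ t → ω t ≈ a * w c i t + b * w c j t
        tail-eqn : ∀ k t → v k t ≈ a * p k t + b * r k t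

    module _ {n} (ω : Block) (v : V n) (v≢0 : ¬ Zero v) where
      private
        pair : ∀ i j a b → ¬ a ≈ 0# → ¬ b ≈ 0# → ¬ a ≈ b → ¬ Q a v → ¬ Q b v →
               (∀ t → ω t ≈ a * w c i t + b * w c j t) → PairCover ω v
        pair i j a b a≉0 b≉0 a≉b ¬Qa ¬Qb eq = record
          { i = i ; j = j ; a = a ; b = b ; p = p ; r = r
          ; nz-p = par-p , ¬Qb ∘ p-zero ; nz-r = par-r , ¬Qa ∘ r-zero
          ; head-eqn = eq ; tail-eqn = eqn }
          where open Decomposition (decompose a b a≉0 b≉0 a≉b v)

        -- a = e + (a + e); of two choices of e at most one is spoilt, since Q holds for at most one scalar.
        single : ∀ i a → ¬ a ≈ 0# → (∀ t → ω t ≈ a * w c i t) → PairCover ω v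
        single i a a≉0 eq with avoid₄ 0# a 0# a
        ... | e , e≉0 , e≉a , _ with avoid₄ 0# a e (a + e) | Q? e v | Q? (a + e) v
        ...   | f , f≉0 , f≉a , f≉e , f≉a+e | Qe | Qa+e = choose Qe Qa+e
          where
          use : ∀ e → ¬ e ≈ 0# → ¬ e ≈ a → ¬ Q e v → ¬ Q (a + e) v → PairCover ω v
          use e e≉0 e≉a ¬Qe ¬Qa+e = pair i i e (a + e) e≉0 (e≉a ∘ sym ∘ +≈0⇒≈)
            (λ h → a≉0 (trans (solve 2 (λ a e → a := e :+ (a :+ e)) refl a e) (≈⇒+≈0 h))) ¬Qe ¬Qa+e
            (λ t → trans (eq t) (solve 3 (λ a e x → a :* x := e :* x :+ (a :+ e) :* x) refl a e (w c i t)))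
          choose : Dec (Q e v) → Dec (Q (a + e) v) → PairCover ω v
          choose (no ¬Qe) (no ¬Qa+e) = use e e≉0 e≉a ¬Qe ¬Qa+e
          choose (yes Qe) _ = use f f≉0 f≉a (λ Qf → f≉e (Q-unique v≢0 Qf Qe))
            (λ Qaf → f≉a+e (+≈0⇒≈ (trans (solve 3 (λ a e f → f :+ (a :+ e) := (a :+ f) :+ e) refl a e f)
                                     (≈⇒+≈0 (Q-unique v≢0 Qaf Qe)))))
          choose (no _) (yes Qae) = use f f≉0 f≉a (λ Qf → f≉a+e (Q-unique v≢0 Qf Qae))
            (λ Qaf → f≉e (+≈0⇒≈ (trans (solve 3 (λ a e f → f :+ e := (a :+ f) :+ (a :+ e)) refl a e f)
                                   (≈⇒+≈0 (Q-unique v≢0 Qaf Qae)))))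

        α = ω 0F
        β = ω 1F
        -- The scalar for which θ w₂ has second entry β; ω is a multiple of w₂ exactly if α = θ.
        θ = β * inv c

        cθ≈β : c * θ ≈ β
        cθ≈β = begin
          c * (β * inv c)   ≈⟨ solve 3 (λ c b i → c :* (b :* i) := b :* (c :* i)) refl c β (inv c) ⟩
          β * (c * inv c)   ≈⟨ *-congˡ (invʳ c≉0) ⟩
          β * 1#            ≈⟨ *-identityʳ β ⟩
          β                 ∎

        θ≉0 : ¬ β ≈ 0# → ¬ θ ≈ 0#
        θ≉0 β≉0 = *-≉0 β≉0 (inv-≉0 c≉0)

        module Generic (α≉0 : ¬ α ≈ 0#) (β≉0 : ¬ β ≈ 0#) (α≉θ : ¬ α ≈ θ) where
          α+θ≉0 : ¬ α + θ ≈ 0#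
          α+θ≉0 = α≉θ ∘ +≈0⇒≈

          α+θ≉α : ¬ α + θ ≈ α
          α+θ≉α h = θ≉0 β≉0 (trans (solve 2 (λ a b → b := (a :+ b) :+ a) refl α θ) (≈⇒+≈0 h))

          pair₀₁ : ¬ α ≈ β → ¬ Q α v → ¬ Q β v → PairCover ω v
          pair₀₁ α≉β ¬Qα ¬Qβ = pair 0F 1F α β α≉0 β≉0 α≉β ¬Qα ¬Qβ λ
            { 0F → solve 2 (λ a b → a := a :* con true :+ b :* con false) refl α β
            ; 1F → solve 2 (λ a b → b := a :* con false :+ b :* con true) refl α β }

          pair₀₂ : ¬ Q (α + θ) v → ¬ Q θ v → PairCover ω v
          pair₀₂ ¬Qα+θ ¬Qθ = pair 0F 2F (α + θ) θ α+θ≉0 (θ≉0 β≉0)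
            (λ h → α≉0 (trans (solve 2 (λ a b → a := (a :+ b) :+ b) refl α θ) (≈⇒+≈0 h))) ¬Qα+θ ¬Qθ λ
            { 0F → solve 2 (λ a b → a := (a :+ b) :* con true :+ b :* con true) refl α θ
            ; 1F → trans (sym cθ≈β) (solve 3 (λ a b c → c :* b := (a :+ b) :* con false :+ b :* c) refl α θ c) }

          pair₁₂ : ¬ c * (α + θ) ≈ α → ¬ Q (c * (α + θ)) v → ¬ Q α v → PairCover ω v
          pair₁₂ ≉α ¬Qc ¬Qα = pair 1F 2F (c * (α + θ)) α (*-≉0 c≉0 α+θ≉0) α≉0 ≉α ¬Qc ¬Qα λ
            { 0F → solve 2 (λ a b → a := b :* con false :+ a :* con true) refl α (c * (α + θ))
            ; 1F → trans (sym cθ≈β) (solve 3 (λ a b c → c :* b := c :* (a :+ b) :* con true :+ a :* c) refl α θ c) }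

          -- The three ways to write ω use the scalars {α, β}, {α + θ, θ} and {c (α + θ), α}. A way
          -- fails if its scalars coincide or `Q` holds for one of them, and `Q` holds for at most
          -- one scalar. If this is θ or α + θ, the second way is lost, and equations that make both
          -- of the others fail contradict the assumptions on ω or c; c² + c + 1 ≠ 0 enters when α =
          -- β or c (α + θ) = α.
          cover : PairCover ω v
          cover with Q? θ v
          ... | yes Qθ with α ≟ β
          ...   | no α≉β = pair₀₁ α≉β (λ Qα → α≉θ (Q-unique v≢0 Qα Qθ))
                  (λ Qβ → *-≉0 1+c≉0 (θ≉0 β≉0) (begin
                     (1# + c) * θ   ≈⟨ solve 2 (λ c t → (con true :+ c) :* t := t :+ c :* t) refl c θ ⟩
                     θ + c * θ      ≈⟨ ≈⇒+≈0 (trans (Q-unique v≢0 Qθ Qβ) (sym cθ≈β)) ⟩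
                     0#             ∎))
          ...   | yes α≈β = pair₁₂
                  (λ h → *-≉0 c≉0 α≉0 (begin
                     c * α                      ≈⟨ solve 3 (λ a t c → c :* a := (c :* (a :+ t) :+ a) :+ (c :* t :+ a)) refl α θ c ⟩
                     (c * (α + θ) + α) + (c * θ + α)
                                                ≈⟨ +-cong (≈⇒+≈0 h) (≈⇒+≈0 (trans cθ≈β (sym α≈β))) ⟩
                     0# + 0#                    ≈⟨ +-identityˡ 0# ⟩
                     0#                         ∎))
                  (λ Qc → *-≉0 c²+c+1≉0 (θ≉0 β≉0) (begin
                     (c * c + c + 1#) * θ       ≈⟨ solve 3 (λ a t c → (c :* c :+ c :+ con true) :* t :=
                                                     (t :+ c :* (a :+ t)) :+ c :* (c :* t :+ a)) refl α θ c ⟩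
                     (θ + c * (α + θ)) + c * (c * θ + α)
                                                ≈⟨ +-cong (≈⇒+≈0 (Q-unique v≢0 Qθ Qc))
                                                     (*-congˡ (≈⇒+≈0 (trans cθ≈β (sym α≈β)))) ⟩
                     0# + c * 0#                ≈⟨ trans (+-identityˡ _) (zeroʳ c) ⟩
                     0#                         ∎))
                  (λ Qα → α≉θ (Q-unique v≢0 Qα Qθ))
          cover | no ¬Qθ with Q? (α + θ) v
          ...   | no ¬Qα+θ = pair₀₂ ¬Qα+θ ¬Qθ
          ...   | yes Qα+θ with c * (α + θ) ≟ α
          ...     | no ≉α = pair₁₂ ≉α
                    (λ Qc → *-≉0 1+c≉0 α+θ≉0 (begin
                       (1# + c) * (α + θ)      ≈⟨ solve 2 (λ c t → (con true :+ c) :* t := t :+ c :* t) refl c (α + θ) ⟩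
                       (α + θ) + c * (α + θ)   ≈⟨ ≈⇒+≈0 (Q-unique v≢0 Qα+θ Qc) ⟩
                       0#                      ∎))
                    (λ Qα → α+θ≉α (Q-unique v≢0 Qα+θ Qα))
          ...     | yes ≈α = pair₀₁
                    (λ α≈β → *-≉0 c≉0 α≉0 (begin
                       c * α                      ≈⟨ solve 3 (λ a t c → c :* a := (c :* (a :+ t) :+ a) :+ (c :* t :+ a)) refl α θ c ⟩
                       (c * (α + θ) + α) + (c * θ + α)
                                                  ≈⟨ +-cong (≈⇒+≈0 ≈α) (≈⇒+≈0 (trans cθ≈β (sym α≈β))) ⟩
                       0# + 0#                    ≈⟨ +-identityˡ 0# ⟩
                       0#                         ∎))
                    (λ Qα → α+θ≉α (Q-unique v≢0 Qα+θ Qα))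
                    (λ Qβ → *-≉0 c²+c+1≉0 (θ≉0 β≉0) (begin
                       (c * c + c + 1#) * θ    ≈⟨ solve 3 (λ a t c → (c :* c :+ c :+ con true) :* t :=
                                                    (con true :+ c) :* ((a :+ t) :+ c :* t) :+ (c :* (a :+ t) :+ a)) refl α θ c ⟩
                       (1# + c) * ((α + θ) + c * θ) + (c * (α + θ) + α)
                                               ≈⟨ +-cong (*-congˡ (≈⇒+≈0 (trans (Q-unique v≢0 Qα+θ Qβ) (sym cθ≈β)))) (≈⇒+≈0 ≈α) ⟩
                       (1# + c) * 0# + 0#      ≈⟨ trans (+-identityʳ _) (zeroʳ _) ⟩
                       0#                      ∎))

      pair-cover : ¬ Zero₂ ω → PairCover ω v
      pair-cover ω≢0 with β ≟ 0# | α ≟ 0# | α ≟ θ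
      ... | yes β≈0 | _ | _ = single 0F α (λ α≈0 → ω≢0 λ { 0F → α≈0 ; 1F → β≈0 })
              λ { 0F → sym (*-identityʳ α) ; 1F → trans β≈0 (sym (zeroʳ α)) }
      ... | no β≉0 | yes α≈0 | _ = single 1F β β≉0 λ { 0F → trans α≈0 (sym (zeroʳ β)) ; 1F → sym (*-identityʳ β) }
      ... | no β≉0 | no α≉0 | yes α≈θ = single 2F α α≉0
              λ { 0F → sym (*-identityʳ α) ; 1F → trans (sym cθ≈β) (trans (*-comm c θ) (*-congʳ (sym α≈θ))) }
      ... | no β≉0 | no α≉0 | no α≉θ = Generic.cover α≉0 β≉0 α≉θ

    layer-cover : ∀ {n} {A : Fin 3 → V n → Set} {S : V n → Set} → (∀ i p → NzPar p → A i p) →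
                  (v : V (suc n)) → ¬ Zero₂ (v zero) → ¬ Zero (tail v) → Covers (Layer c A S) v
    layer-cover Nz⊆A v ω≢0 v≢0 =
      cons (w c i) p , cons (w c j) r , a , b ,
      up i (λ _ → refl) (Nz⊆A i p nz-p) , up j (λ _ → refl) (Nz⊆A j r nz-r) ,
      λ { zero → head-eqn ; (suc k) → tail-eqn k }
      where open PairCover (pair-cover (v zero) (tail v) v≢0 ω≢0)

    layer-cover-down : ∀ {n} {c′} {A : Fin 3 → V n → Set} {S : V n → Set} (v : V (suc n)) →
                       Zero₂ (v zero) → Covers S (tail v) → Covers (Layer c′ A S) v
    layer-cover-down v ω≈0 (p , r , a , b , Sp , Sr , eq) =
      cons (λ _ → 0#) p , cons (λ _ → 0#) r , a , b , down (λ _ → refl) Sp , down (λ _ → refl) Sr ,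
      λ { zero t → trans (ω≈0 t) (solve 2 (λ a b → con false := a :* con false :+ b :* con false) refl a b)
        ; (suc k) → eq k }

    -- The square of x + c y + z = 0 added to x² + c y² + z² = 0 leaves (c² + c) y² = 0 in every
    -- block, so r would vanish.
    par-transversal : ∀ {n} (p r s : V n) → Par p → NzPar r → Par s → ¬ (∀ j t → p j t + c * r j t + s j t ≈ 0#)
    par-transversal p r s pp (pr , r≢0) ps h = r≢0 (Par-zero pr λ j →
      sq-≈0 (*-≈0 c≉0 (*-≈0 1+c≉0 (begin
        (1# + c) * (c * (r j 0F * r j 0F))
          ≈⟨ solve 4 (λ c x y z → (con true :+ c) :* (c :* (y :* y)) :=
               (x :+ c :* y :+ z) :* (x :+ c :* y :+ z) :+ (x :* x :+ c :* (y :* y) :+ z :* z))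
               refl c (p j 0F) (r j 0F) (s j 0F) ⟩
        (p j 0F + c * r j 0F + s j 0F) * (p j 0F + c * r j 0F + s j 0F) +
        (p j 0F * p j 0F + c * (r j 0F * r j 0F) + s j 0F * s j 0F)
          ≈⟨ +-cong (*-congʳ (h j 0F)) (+-cong (+-cong (sym (pp j)) (*-congˡ (sym (pr j)))) (sym (ps j))) ⟩
        0# * _ + (p j 1F + c * r j 1F + s j 1F)
          ≈⟨ +-cong (zeroˡ _) (h j 1F) ⟩
        0# + 0#  ≈⟨ +-identityˡ 0# ⟩
        0#       ∎))))

    -- A projective point has at most one representative in `Par`: e x² = (e x)² forces e = 1
    -- wherever e x ≠ 0.
    par-scale : ∀ {n} e (s p : V n) → NzPar s → Par p → (∀ j t → s j t ≈ e * p j t) → e ≈ 1#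
    par-scale e s p (ps , s≢0) pp h with e ≟ 1#
    ... | yes e≈1 = e≈1
    ... | no e≉1 = contradiction (Par-zero ps λ j → sq-≈0 (trans (sym (ps j)) (*-≈0 (e≉1 ∘ +≈0⇒≈) (begin
        (e + 1#) * s j 1F
          ≈⟨ solve 2 (λ e y → (e :+ con true) :* y := e :* y :+ y) refl e (s j 1F) ⟩
        e * s j 1F + s j 1F
          ≈⟨ +-cong (*-congˡ (trans (h j 1F) (*-congˡ (pp j)))) (trans (ps j) (*-cong (h j 0F) (h j 0F))) ⟩
        e * (e * (p j 0F * p j 0F)) + (e * p j 0F) * (e * p j 0F)
          ≈⟨ solve 2 (λ e x → e :* (e :* (x :* x)) :+ (e :* x) :* (e :* x) := con false) refl e (p j 0F) ⟩
        0# ∎)))) s≢0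

    NzPar-affineCap : ∀ {n} → AffineCap (NzPar {n})
    NzPar-affineCap p r s a b d (pp , _) (pr , _) (ps , _) = Par-affineCap p r s a b d pp pr ps

    -- The lowest layer of Lower consists of the two points (1,0) and (0,1); in a higher layer the vectors above
    -- (0,1) must be nonzero for par-transversal, and those above (1,c) because (1,c,0) is a direction of Par.
    MiddlePart : ∀ m → V m → Set
    MiddlePart zero = Par
    MiddlePart (suc m) = NzPar

    LowerPart : ∀ m → Fin 3 → V m → Set
    LowerPart m 0F = Par
    LowerPart m 1F = MiddlePart m
    LowerPart m 2F = NzPar

    -- A cap containing no scalar multiple of a vector of `Par` (`Lower-direction`) and covering
    -- every point that is no such multiple (`Lower-cover`). The multiples are the chord directions
    -- of `Par` and are left to the affine part.
    Lower : ∀ m → V m → Set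
    Lower zero v = ⊥
    Lower (suc m) = Layer c (LowerPart m) (Lower m)

    LowerPart⊆Par : ∀ m i p → LowerPart m i p → Par p
    LowerPart⊆Par m 0F p pp = pp
    LowerPart⊆Par zero 1F p pp = pp
    LowerPart⊆Par (suc m) 1F p (pp , _) = pp
    LowerPart⊆Par m 2F p (pp , _) = pp

    NzPar⊆LowerPart : ∀ m i p → NzPar p → LowerPart m i p
    NzPar⊆LowerPart m 0F p (pp , _) = pp
    NzPar⊆LowerPart zero 1F p (pp , _) = pp
    NzPar⊆LowerPart (suc m) 1F p nz = nz
    NzPar⊆LowerPart m 2F p nz = nz

    -- A multiple of a vector of `Par` has blocks (e x, e x²). Such a block is never (1,0) or (0,1);
    -- if it is (1,c), the nonzero tail gives e = 1 by `par-scale`, whence x = 1 and c = 1.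
    Lower-direction : ∀ m s e p → Lower m s → Par p → ¬ (∀ i t → s i t ≈ e * p i t)
    Lower-direction (suc m) s e p s∈ pp h = go s∈
      where
      x y : Carrier
      x = e * p zero 0F
      y = e * p zero 1F
      y≈ : y ≈ x * p zero 0F
      y≈ = trans (*-congˡ (pp zero)) (sym (*-assoc _ _ _))
      go : ¬ Lower (suc m) s
      go (up 0F hd _) = 1≉0 (begin
        1#                ≈⟨ 1≈x ⟩
        x                 ≈⟨ *-congˡ (trans (sym (*-identityˡ _)) (*-congʳ 1≈x)) ⟩
        e * (x * p zero 0F) ≈⟨ *-congˡ y≈ ⟨
        e * y             ≈⟨ *-congˡ (trans (sym (h zero 1F)) (hd 1F)) ⟩
        e * 0#            ≈⟨ zeroʳ e ⟩
        0#                ∎)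
        where
        1≈x : 1# ≈ x
        1≈x = trans (sym (hd 0F)) (h zero 0F)
      go (up 1F hd _) = 1≉0 (begin
        1#                ≈⟨ trans (sym (hd 1F)) (h zero 1F) ⟩
        y                 ≈⟨ y≈ ⟩
        x * p zero 0F     ≈⟨ *-congʳ (trans (sym (h zero 0F)) (hd 0F)) ⟩
        0# * p zero 0F    ≈⟨ zeroˡ _ ⟩
        0#                ∎)
      go (up 2F hd nz) = c≉1 (begin
        c                 ≈⟨ trans (sym (hd 1F)) (h zero 1F) ⟩
        y                 ≈⟨ y≈ ⟩
        x * p zero 0F     ≈⟨ *-cong (trans (sym (h zero 0F)) (hd 0F))
                               (trans (sym (*-identityˡ _)) (*-congʳ (sym e≈1))) ⟩
        1# * x            ≈⟨ *-congˡ (trans (sym (h zero 0F)) (hd 0F)) ⟩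
        1# * 1#           ≈⟨ *-identityˡ 1# ⟩
        1#                ∎)
        where
        e≈1 : e ≈ 1#
        e≈1 = par-scale e (tail s) (tail p) nz (pp ∘ suc) (h ∘ suc)
      go (down hd s∈) = Lower-direction m (tail s) e (tail p) s∈ (pp ∘ suc) (h ∘ suc)

    Lower-cap : ∀ m → Cap (Lower m)
    Lower-cap zero = record { nonzero = λ _ () ; no-line = λ _ _ _ _ _ _ () }
    Lower-cap (suc m) = layer-cap c≉0
      (λ i p r s a b d Ap Ar As → Par-affineCap p r s a b d
        (LowerPart⊆Par m i p Ap) (LowerPart⊆Par m i r Ar) (LowerPart⊆Par m i s As))
      (Lower-cap m)
      (λ i p r s e Ap Ar Ss → Lower-direction m s e _ Ss (Par-+ p r (LowerPart⊆Par m i p Ap) (LowerPart⊆Par m i r Ar)))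
      (transversal m)
      where
      transversal : ∀ m (p r s : V m) → LowerPart m 0F p → LowerPart m 1F r → LowerPart m 2F s →
                    ¬ (∀ j t → p j t + c * r j t + s j t ≈ 0#)
      -- In the lowest layer nothing lies over (1,c), since a vector without blocks is never
      -- nonzero.
      transversal zero p r s _ _ (_ , s≢0) = contradiction (λ ()) s≢0
      transversal (suc m) p r s pp nr (ps , _) = par-transversal p r s pp nr ps

    Lower-cover : ∀ m (v : V (suc m)) →
                  (∃ λ e → ∃ λ p → Par p × (∀ i t → v i t ≈ e * p i t)) ⊎ Covers (Lower (suc m)) v
    Lower-cover m v with Fin.all? (λ t → v zero t ≟ 0#) | Zero? (tail v)
    ... | no ω≢0 | no v≢0 = inj₂ (layer-cover (NzPar⊆LowerPart m) v ω≢0 v≢0)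
    -- The zero vector counts as the multiple of `Par` with scalar 0.
    Lower-cover zero v | yes ω≈0 | _ =
      inj₁ (0# , (λ _ _ → 0#) , (λ _ → sym (zeroˡ _)) , λ { zero t → trans (ω≈0 t) (sym (zeroˡ _)) })
    Lower-cover (suc m) v | yes ω≈0 | _ with Lower-cover m (tail v)
    ... | inj₂ cov = inj₂ (layer-cover-down v ω≈0 cov)
    ... | inj₁ (e , p , pp , eq) = inj₁ (e , cons (λ _ → 0#) p ,
            (λ { zero → sym (zeroˡ _) ; (suc i) → pp i }) ,
            λ { zero t → trans (ω≈0 t) (sym (zeroʳ e)) ; (suc i) → eq i })
    Lower-cover m v | no ω≢0 | yes v≈0 with v zero 0F ≟ 0# | v zero 1F ≟ 0#
    ... | yes x≈0 | yes y≈0 = contradiction (λ { 0F → x≈0 ; 1F → y≈0 }) ω≢0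
    ... | no x≉0 | yes y≈0 = inj₂ (point , point , v zero 0F , 0# , ∈point , ∈point ,
            λ { zero 0F → solve 1 (λ x → x := x :* con true :+ con false :* con true) refl (v zero 0F)
              ; zero 1F → trans y≈0 (solve 1 (λ x → con false := x :* con false :+ con false :* con false) refl (v zero 0F))
              ; (suc i) t → trans (v≈0 i t) (solve 1 (λ x → con false := x :* con false :+ con false :* con false) refl (v zero 0F)) })
          where
          point : V (suc m)
          point = cons (w c 0F) (λ _ _ → 0#)
          ∈point : Lower (suc m) point
          ∈point = up 0F (λ _ → refl) (λ _ → sym (zeroˡ _))
    Lower-cover m v | no ω≢0 | yes v≈0 | no x≉0 | no y≉0 =
        -- The equation (x, y) = e (s, s²) has the solution s = y / x, e = x² / y.
        inj₁ (x * z , cons u (λ _ _ → 0#) ,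
          (λ { zero → refl ; (suc i) → sym (zeroˡ _) }) ,
          λ { zero 0F → sym (trans (*-assoc x z (y * ι)) (trans (*-congˡ zyι) (*-identityʳ x)))
            ; zero 1F → sym (begin
                x * z * ((y * ι) * (y * ι))   ≈⟨ solve 4 (λ x z y i → x :* z :* ((y :* i) :* (y :* i)) :=
                                                   y :* (x :* i) :* (z :* (y :* i))) refl x z y ι ⟩
                y * (x * ι) * (z * (y * ι))   ≈⟨ *-cong (trans (*-congˡ (invʳ x≉0)) (*-identityʳ y)) zyι ⟩
                y * 1#                        ≈⟨ *-identityʳ y ⟩
                y                             ∎)
            ; (suc i) t → trans (v≈0 i t) (sym (zeroʳ _)) })
      where
      x y z ι : Carrier
      x = v zero 0F
      y = v zero 1F
      ι = inv x
      z = x * inv y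
      u : Block
      u 0F = y * ι
      u 1F = (y * ι) * (y * ι)
      zyι : z * (y * ι) ≈ 1#
      zyι = begin
        x * inv y * (y * ι)     ≈⟨ solve 4 (λ x j y i → x :* j :* (y :* i) := (x :* i) :* (y :* j)) refl x (inv y) y ι ⟩
        (x * ι) * (y * inv y)   ≈⟨ *-cong (invʳ x≉0) (invʳ y≉0) ⟩
        1# * 1#                 ≈⟨ *-identityˡ 1# ⟩
        1#                      ∎
    Lower-cover zero v | no ω≢0 | yes v≈0 | yes x≈0 | no y≉0 = inj₂ (point , point , v zero 1F , 0# , ∈point , ∈point ,
            λ { zero 0F → trans x≈0 (solve 1 (λ x → con false := x :* con false :+ con false :* con false) refl (v zero 1F))
              ; zero 1F → solve 1 (λ x → x := x :* con true :+ con false :* con true) refl (v zero 1F) })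
          where
          point : V 1
          point = cons (w c 1F) (λ ())
          ∈point : Lower 1 point
          ∈point = up 1F (λ _ → refl) (λ ())
    Lower-cover (suc m) v | no ω≢0 | yes v≈0 | yes x≈0 | no y≉0 =
        -- Points over (1,0) and (1,c) with equal tails add up to (0, c) with zero tail, so θ = y /
        -- c. The tail is all ones because a tail over (1,c) has to be nonzero and on `Par`.
        inj₂ (cons (w c 0F) one , cons (w c 2F) one , θ , θ ,
          up 0F (λ _ → refl) (proj₁ nz-one) , up 2F (λ _ → refl) nz-one ,
          λ { zero 0F → trans x≈0 (sym (x+x≈0 _))
            ; zero 1F → begin
                v zero 1F                     ≈⟨ *-identityʳ _ ⟨
                v zero 1F * 1#                ≈⟨ *-congˡ (invʳ c≉0) ⟨
                v zero 1F * (c * inv c)       ≈⟨ solve 3 (λ y c i → y :* (c :* i) := y :* i :* con false :+ y :* i :* c)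
                                                   refl (v zero 1F) c (inv c) ⟩
                θ * 0# + θ * c                ∎
            ; (suc i) t → trans (v≈0 i t) (sym (x+x≈0 _)) })
      where
      θ = v zero 1F * inv c
      one : V (suc m)
      one _ _ = 1#
      nz-one : NzPar one
      nz-one = (λ _ → sym (*-identityˡ 1#)) , λ z → 1≉0 (z zero 0F)

    -- The leading block here is the one that K occupies in the affine part. Zero tails are left out
    -- over all three w: points (ω, 0) are covered by chords of K and must not belong to the cap.
    Upper : ∀ m → V (suc m) → Set
    Upper m = Layer c (λ _ → NzPar) (Lower m)

    Upper-cap : ∀ m → Cap (Upper m)
    Upper-cap m = layer-cap c≉0 (λ _ → NzPar-affineCap) (Lower-cap m)
      (λ i p r s e Ap Ar Ss → Lower-direction m s e _ Ss (Par-+ p r (proj₁ Ap) (proj₁ Ar)))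
      (λ p r s Ap Ar As → par-transversal p r s (proj₁ Ap) Ar (proj₁ As))

    -- In the top layer the nonzero tail forces the scalar to be 1 by `par-scale`, so the leading
    -- block of p is itself some w. For p a difference of affine points, only the difference of the
    -- leading blocks then matters.
    Upper-direction : ∀ m s e p → Upper m s → Par (tail p) → (∀ i t → s i t ≈ e * p i t) → ∃ λ i → p zero ≈₂ w c i
    Upper-direction m s e p (up i hd nz) pp h = i , λ t →
      trans (sym (*-identityˡ _)) (trans (*-congʳ (sym (par-scale e (tail s) (tail p) nz pp (h ∘ suc))))
        (trans (sym (h zero t)) (hd t)))
    Upper-direction m s e p (down _ s∈) pp h = contradiction (h ∘ suc) (Lower-direction m (tail s) e (tail p) s∈ pp)

-- From complete arcs to arcs in an affine plane

module Arcs (F : CommutativeRing 0ℓ 0ℓ) (q : ℕ) (ff : IsFiniteField F q) (pow : IsPowerOf2 q) (8<q : 8 < q) where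
  open CommutativeRing F hiding (zero)
  open IsFiniteField ff
  open Char2 F q ff pow
  open Levels F q ff pow
  open Coverage F q ff pow 8<q
  open Projective F
  open import Algebra.Properties.CommutativeSemigroup +-commutativeSemigroup using (interchange)
  open import Relation.Binary.Reasoning.Setoid setoid

  Block-setoid : Setoid 0ℓ 0ℓ
  Block-setoid = ≋-setoid setoid 2

  infix 4 _≟₂_
  _≟₂_ : (u v : Block) → Dec (u ≈₂ v)
  u ≟₂ v = Fin.all? λ t → u t ≟ v t

  block : Carrier → Carrier → Block
  block x y 0F = x
  block x y 1F = y

  enum-Block : Enumeration Block-setoid (λ _ → ⊤) (q ℕ.* q)
  enum-Block = enum-map (λ (x , y) → block x y)
    (λ { (eq₁ , eq₂) 0F → eq₁ ; (eq₁ , eq₂) 1F → eq₂ }) (λ eq → eq 0F , eq 1F) (λ _ _ → tt)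
    (λ u _ → (u 0F , u 1F) , (tt , tt) , λ { 0F → refl ; 1F → refl })
    (enum-× enum-F enum-F)

  avoid-Block : ∀ {n} → n < q ℕ.* q → (g : Fin n → Block) → ∃ λ u → ∀ i → ¬ g i ≈₂ u
  avoid-Block = avoid enum-Block _≟₂_

  -- The weights 1 + s and s are nonzero and distinct, as `decompose` requires. Since p = r is
  -- allowed, points of K are never off the chords.
  OffChords NoChordDirection : (Block → Set) → Block → Set
  OffChords K u = ∀ p r s → K p → K r → ¬ s ≈ 0# → ¬ s ≈ 1# → ¬ (∀ t → u t ≈ (1# + s) * p t + s * r t)
  NoChordDirection K u = ∀ p r e → K p → K r → ¬ (∀ t → u t ≈ e * (p t + r t))

  -- The covering properties are negations because completeness of an arc only says that no
  -- extension is a cap.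
  record AffineArc (K : Block → Set) (k : ℕ) : Set where
    field
      resp        : ∀ {u v} → u ≈₂ v → K u → K v
      enumeration : Enumeration Block-setoid K k
      arc         : ∀ u v x a b d → K u → K v → K x → ¬ a ≈ 0# → ¬ b ≈ 0# → ¬ d ≈ 0# →
                    a + b + d ≈ 0# → (∀ t → R3 a b d (u t) (v t) (x t)) → u ≈₂ v
      covers-point     : ∀ u → ¬ OffChords K u
      covers-direction : ∀ u → ¬ Zero₂ u → ¬ NoChordDirection K u

  isolate : ∀ {a x y} → ¬ a ≈ 0# → a * x + y ≈ 0# → x ≈ inv a * y
  isolate {a} {x} {y} a≉0 h = *-cancelˡ a≉0 (begin
    a * x             ≈⟨ +≈0⇒≈ h ⟩
    y                 ≈⟨ *-identityˡ y ⟨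
    1# * y            ≈⟨ *-congʳ (invʳ a≉0) ⟨
    a * inv a * y     ≈⟨ *-assoc _ _ _ ⟩
    a * (inv a * y)   ∎)

  form : Block → Vect 2 → Carrier
  form l x = x 0F + l 0F * x 1F + l 1F * x 2F

  form-zero : ∀ l x → IsZero x → form l x ≈ 0#
  form-zero l x z = begin
    x 0F + l 0F * x 1F + l 1F * x 2F   ≈⟨ +-cong (+-cong (z 0F) (*-congˡ (z 1F))) (*-congˡ (z 2F)) ⟩
    0# + l 0F * 0# + l 1F * 0#         ≈⟨ solve 2 (λ l m → con false :+ l :* con false :+ m :* con false := con false)
                                            refl (l 0F) (l 1F) ⟩
    0#                                 ∎

  form-+ : ∀ l x y → form l x + form l y ≈ form l (λ t → x t + y t)
  form-+ l x y = trans (interchange _ _ _ _)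
    (+-cong (trans (interchange _ _ _ _) (+-congˡ (sym (distribˡ _ _ _)))) (sym (distribˡ _ _ _)))

  form-* : ∀ l a x → a * form l x ≈ form l (λ t → a * x t)
  form-* l a x = solve 6 (λ a x y z l m → a :* (x :+ l :* y :+ m :* z) := a :* x :+ l :* (a :* y) :+ m :* (a :* z))
    refl a (x 0F) (x 1F) (x 2F) (l 0F) (l 1F)

  form-R3 : ∀ l {a b d} x y z → (∀ t → R3 a b d (x t) (y t) (z t)) → R3 a b d (form l x) (form l y) (form l z)
  form-R3 l {a} {b} {d} x y z h = trans
    (+-cong (trans (+-cong (form-* l a x) (form-* l b y)) (form-+ l (λ t → a * x t) (λ t → b * y t))) (form-* l d z))
    (trans (form-+ l (λ t → a * x t + b * y t) (λ t → d * z t)) (form-zero l _ h))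

  k*q<q*q : ∀ {k} → k < q → k ℕ.* q < q ℕ.* q
  k*q<q*q k<q = ℕₚ.*-monoˡ-< q {{ℕ.>-nonZero (ℕₚ.≤-trans (s≤s z≤n) k<q)}} k<q

  -- As s varies this runs through all l with x₀ + l₀ x₁ + l₁ x₂ = 0 (junk if x₁ = x₂ = 0, when there are none).
  vanishing : Vect 2 → Carrier → Block
  vanishing x s with x 1F ≟ 0#
  ... | no _ = block ((x 0F + s * x 2F) * inv (x 1F)) s
  ... | yes _ = block s (x 0F * inv (x 2F))

  -- Stated for every s′ ≈ s because the parameter arrives later as `enum (index s)`.
  vanishing-complete : ∀ x l → ¬ IsZero x → form l x ≈ 0# →
                       ∃ λ s → ∀ s′ → s′ ≈ s → vanishing x s′ ≈₂ l
  vanishing-complete x l x≢0 h with x 1F ≟ 0#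
  ... | no x₁≉0 = l 1F , λ { s′ eq 0F → sym (trans (isolate x₁≉0 (trans
          (solve 5 (λ x y z b c → y :* b :+ (x :+ c :* z) := x :+ b :* y :+ c :* z) refl (x 0F) (x 1F) (x 2F) (l 0F) (l 1F)) h))
          (trans (*-comm _ _) (*-congʳ (+-congˡ (*-congʳ (sym eq))))))
        ; s′ eq 1F → eq }
  ... | yes x₁≈0 = l 0F , λ { s′ eq 0F → eq ; s′ eq 1F → sym (trans (isolate x₂≉0 h′) (*-comm _ _)) }
    where
    h′ : x 2F * l 1F + x 0F ≈ 0#
    h′ = begin
      x 2F * l 1F + x 0F               ≈⟨ solve 4 (λ x z b c → z :* c :+ x := x :+ b :* con false :+ c :* z)
                                            refl (x 0F) (x 2F) (l 0F) (l 1F) ⟩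
      x 0F + l 0F * 0# + l 1F * x 2F   ≈⟨ +-congʳ (+-congˡ (*-congˡ x₁≈0)) ⟨
      form l x                         ≈⟨ h ⟩
      0#                               ∎
    x₂≉0 : ¬ x 2F ≈ 0#
    x₂≉0 x₂≈0 = x≢0 λ
      { 0F → trans (solve 2 (λ x c → x := con false :* c :+ x) refl (x 0F) (l 1F)) (trans (+-congʳ (*-congʳ (sym x₂≈0))) h′)
      ; 1F → x₁≈0 ; 2F → x₂≈0 }

  -- There are q² lines x₀ + l₀ x₁ + l₁ x₂ = 0 and at most q of them pass through a given point; k q
  -- < q² leaves one that misses the arc.
  external-line : ∀ {k} → k < q → (P : Fin k → Vect 2) → (∀ i → ¬ IsZero (P i)) → ∃ λ l → ∀ i → ¬ form l (P i) ≈ 0#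
  external-line k<q P nonzero = proj₁ avoided , λ i h →
      let s , hit = vanishing-complete (P i) (proj₁ avoided) (nonzero i) h
      in proj₂ avoided (combine i (index s)) λ t → trans
           (reflexive (≡.cong (λ (i , s) → vanishing (P i) (enum s) t) (Fin.remQuot-combine i (index s))))
           (hit (enum (index s)) (enum-index s) t)
    where
    avoided = avoid-Block (k*q<q*q k<q) (λ j → let i , s = remQuot q j in vanishing (P i) (enum s))

  module Dehomogenise {k : ℕ} (P : Fin k → Vect 2) (complete : IsCompleteCap 2 k P)
                      (l : Block) (L≉0 : ∀ i → ¬ form l (P i) ≈ 0#) where
    private
      cap = proj₁ complete

    L : Fin k → Carrier
    L i = form l (P i)

    u : Fin k → Block
    u i t = inv (L i) * P i (suc t)

    K : Block → Set
    K x = ∃ λ i → u i ≈₂ x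

    P-tail : ∀ i t → P i (suc t) ≈ L i * u i t
    P-tail i t = begin
      P i (suc t)                        ≈⟨ *-identityˡ _ ⟨
      1# * P i (suc t)                   ≈⟨ *-congʳ (invʳ (L≉0 i)) ⟨
      L i * inv (L i) * P i (suc t)      ≈⟨ *-assoc _ _ _ ⟩
      L i * u i t                        ∎

    -- The vector with last two coordinates x on which `form l` takes the value ε: an affine point
    -- for ε = 1, a direction for ε = 0.
    lift : Carrier → Block → Vect 2
    lift ε x 0F = ε + l 0F * x 0F + l 1F * x 1F
    lift ε x (suc t) = x t

    P≈lift : ∀ i t → inv (L i) * P i t ≈ lift 1# (u i) t
    P≈lift i 0F = begin
      inv (L i) * P i 0F
        ≈⟨ solve 6 (λ e x y z b c → e :* x := (x :+ b :* y :+ c :* z) :* e :+ b :* (e :* y) :+ c :* (e :* z))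
             refl (inv (L i)) (P i 0F) (P i 1F) (P i 2F) (l 0F) (l 1F) ⟩
      L i * inv (L i) + l 0F * u i 0F + l 1F * u i 1F
        ≈⟨ +-congʳ (+-congʳ (invʳ (L≉0 i))) ⟩
      1# + l 0F * u i 0F + l 1F * u i 1F ∎
    P≈lift i (suc t) = refl

    R3-lift : ∀ {a b d x y z} → a + b + d ≈ 0# → (∀ t → R3 a b d (x t) (y t) (z t)) →
              ∀ t → R3 a b d (lift 1# x t) (lift 1# y t) (lift 1# z t)
    R3-lift {a} {b} {d} {x} {y} {z} sum≈0 h 0F = form-R3 l (1# Vector.∷ x) (1# Vector.∷ y) (1# Vector.∷ z) λ
      { 0F → trans (+-cong (+-cong (*-identityʳ a) (*-identityʳ b)) (*-identityʳ d)) sum≈0 ; (suc t) → h t }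
    R3-lift sum≈0 h (suc t) = h t

    u-injective : ∀ i j → u i ≈₂ u j → i ≡ j
    u-injective i j eq with i Fin.≟ j
    ... | yes i≡j = i≡j
    ... | no i≢j = contradiction
        (inv (L i) , inv (L j) , (λ (z , _) → inv-≉0 (L≉0 i) z) ,
         λ t → ≈⇒+≈0 (trans (P≈lift i t) (trans (lift-cong t) (sym (P≈lift j t)))))
        (proj₁ (proj₂ cap) i j i≢j)
      where
      lift-cong : ∀ t → lift 1# (u i) t ≈ lift 1# (u j) t
      lift-cong 0F = +-cong (+-congˡ (*-congˡ (eq 0F))) (*-congˡ (eq 1F))
      lift-cong (suc t) = eq t

    K-arc : ∀ x y z a b d → K x → K y → K z → ¬ a ≈ 0# → ¬ b ≈ 0# → ¬ d ≈ 0# →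
            a + b + d ≈ 0# → (∀ t → R3 a b d (x t) (y t) (z t)) → x ≈₂ y
    K-arc x y z a b d (i , xi) (j , yj) (m , zm) a≉0 b≉0 d≉0 sum≈0 h with i Fin.≟ j | j Fin.≟ m | i Fin.≟ m
    ... | yes ≡.refl | _ | _ = λ t → trans (sym (xi t)) (yj t)
    ... | no i≢j | yes ≡.refl | _ = λ t → *-cancelˡ a≉0 (begin
        a * x t              ≈⟨ +≈0⇒≈ (trans (sym (+-assoc _ _ _)) (h t)) ⟩
        b * y t + d * z t    ≈⟨ +-congˡ (*-congˡ (trans (sym (zm t)) (yj t))) ⟩
        b * y t + d * y t    ≈⟨ distribʳ _ _ _ ⟨
        (b + d) * y t        ≈⟨ *-congʳ (+≈0⇒≈ (trans (sym (+-assoc _ _ _)) sum≈0)) ⟨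
        a * y t              ∎)
    ... | no i≢j | no _ | yes ≡.refl = λ t → *-cancelˡ b≉0 (+≈0⇒≈ (begin
        b * x t + b * y t                  ≈⟨ solve 4 (λ a b d′ y → b :* d′ :+ b :* y := (a :+ b) :* d′ :+ (a :* d′ :+ b :* y)) refl a b (x t) (y t) ⟩
        (a + b) * x t + (a * x t + b * y t) ≈⟨ +-cong (*-cong (+≈0⇒≈ sum≈0) (trans (sym (xi t)) (zm t))) (+≈0⇒≈ (h t)) ⟩
        d * z t + d * z t                  ≈⟨ x+x≈0 _ ⟩
        0#                                 ∎))
    ... | no i≢j | no j≢m | no i≢m = contradiction
        (a * inv (L i) , b * inv (L j) , d * inv (L m) , (λ (z , _) → *-≉0 a≉0 (inv-≉0 (L≉0 i)) z) ,
         λ t → trans (+-cong (+-cong (move i t) (move j t)) (move m t))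
           (R3-lift sum≈0 (λ t → R3-cong (sym (xi t)) (sym (yj t)) (sym (zm t)) (h t)) t))
        (proj₂ (proj₂ cap) i j m i≢j j≢m i≢m)
      where
      move : ∀ {e} i t → e * inv (L i) * P i t ≈ e * lift 1# (u i) t
      move i t = trans (*-assoc _ _ _) (*-congˡ (P≈lift i t))

    -- By completeness, adding `lift ε x` to the arc destroys the cap property. A dependence
    -- responsible for this has a nonzero coefficient at the new vector, since the old points form a
    -- cap; solving for that vector gives a combination of two arc points, and `form l` shows that
    -- its weights add up to ε.
    spanned : ∀ ε x → ¬ (ε ≈ 0# × Zero₂ x) →
              (∀ i j b d → ε ≈ b + d → ¬ (∀ t → x t ≈ b * u i t + d * u j t)) → ⊥
    spanned ε x nz uncovered = proj₂ complete v
        ( (λ { zero → nonzero ; (suc i) → proj₁ cap i })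
        , (λ { zero zero 0≢0 → contradiction ≡.refl 0≢0
             ; zero (suc j) _ → dep2 j
             ; (suc i) zero _ → λ (a , b , ab , h) → dep2 i (b , a , (λ (b0 , a0) → ab (a0 , b0)) , λ t → trans (+-comm _ _) (h t))
             ; (suc i) (suc j) i≢j → proj₁ (proj₂ cap) i j (i≢j ∘ ≡.cong suc) })
        , (λ { zero zero _ 0≢0 _ _ → contradiction ≡.refl 0≢0
             ; zero (suc j) zero _ _ 0≢0 → contradiction ≡.refl 0≢0
             ; (suc i) zero zero _ 0≢0 _ → contradiction ≡.refl 0≢0
             ; zero (suc i) (suc j) _ i≢j _ → dep3 i j (i≢j ∘ ≡.cong suc)
             ; (suc i) zero (suc j) _ _ i≢j → λ (a , b , d , abd , h) → dep3 i j (i≢j ∘ ≡.cong suc)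
                 (b , a , d , (λ (b0 , a0 , d0) → abd (a0 , b0 , d0)) , λ t → swap₁₂ (h t))
             ; (suc i) (suc j) zero i≢j _ _ → λ (a , b , d , abd , h) → dep3 i j (i≢j ∘ ≡.cong suc)
                 (d , a , b , (λ (d0 , a0 , b0) → abd (a0 , b0 , d0)) , λ t → swap₁₂ (swap₂₃ (h t)))
             ; (suc i) (suc j) (suc m) i≢j j≢m i≢m → proj₂ (proj₂ cap) i j m
                 (i≢j ∘ ≡.cong suc) (j≢m ∘ ≡.cong suc) (i≢m ∘ ≡.cong suc) }) )
      where
      v : Vect 2
      v = lift ε x

      form-lift : form l v ≈ ε
      form-lift = solve 5 (λ e l m x y → (e :+ l :* x :+ m :* y) :+ l :* x :+ m :* y := e)
                    refl ε (l 0F) (l 1F) (x 0F) (x 1F)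

      nonzero : ¬ IsZero v
      nonzero z = nz ((begin
        ε                                       ≈⟨ form-lift ⟨
        form l v                                ≈⟨ form-zero l v z ⟩
        0#                                      ∎) , z ∘ suc)

      span : ∀ i j a b d → ¬ a ≈ 0# → (∀ t → R3 a b d (v t) (P i t) (P j t)) → ⊥
      span i j a b d a≉0 h = uncovered i j (inv a * b * L i) (inv a * d * L j)
        (solved (begin
           a * ε + (b * L i + d * L j)            ≈⟨ +-congʳ (*-congˡ form-lift) ⟨
           a * form l v + (b * L i + d * L j)     ≈⟨ +-assoc _ _ _ ⟨
           a * form l v + b * L i + d * L j       ≈⟨ form-R3 l v (P i) (P j) h ⟩
           0#                                     ∎))
        λ t → begin
          x t                                                   ≈⟨ isolate a≉0 (trans (sym (+-assoc _ _ _)) (h (suc t))) ⟩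
          inv a * (b * P i (suc t) + d * P j (suc t))           ≈⟨ *-congˡ (+-cong (*-congˡ (P-tail i t)) (*-congˡ (P-tail j t))) ⟩
          inv a * (b * (L i * u i t) + d * (L j * u j t))
            ≈⟨ solve 7 (λ e b d m n x y → e :* (b :* (m :* x) :+ d :* (n :* y)) := e :* b :* m :* x :+ e :* d :* n :* y)
                 refl (inv a) b d (L i) (L j) (u i t) (u j t) ⟩
          inv a * b * L i * u i t + inv a * d * L j * u j t     ∎
        where
        solved : a * ε + (b * L i + d * L j) ≈ 0# → ε ≈ inv a * b * L i + inv a * d * L j
        solved eq = trans (isolate a≉0 eq)
          (solve 5 (λ e b d m n → e :* (b :* m :+ d :* n) := e :* b :* m :+ e :* d :* n) refl (inv a) b d (L i) (L j))

      dep2 : ∀ i → ¬ Dep2 v (P i)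
      dep2 i (a , b , ab , h) with a ≟ 0#
      ... | no a≉0 = span i i a b 0# a≉0 λ t → trans (+-congˡ (zeroˡ _)) (trans (+-identityʳ _) (h t))
      ... | yes a≈0 = proj₁ cap i λ t → *-≈0 (λ b≈0 → ab (a≈0 , b≈0)) (begin
          b * P i t               ≈⟨ solve 2 (λ y x → y := con false :* x :+ y) refl (b * P i t) (v t) ⟩
          0# * v t + b * P i t    ≈⟨ +-congʳ (*-congʳ a≈0) ⟨
          a * v t + b * P i t     ≈⟨ h t ⟩
          0#                      ∎)

      dep3 : ∀ i j → i ≢ j → ¬ Dep3 v (P i) (P j)
      dep3 i j i≢j (a , b , d , abd , h) with a ≟ 0#
      ... | no a≉0 = span i j a b d a≉0 h
      ... | yes a≈0 = proj₁ (proj₂ cap) i j i≢j (b , d , (λ (b0 , d0) → abd (a≈0 , b0 , d0)) , λ t → begin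
          b * P i t + d * P j t             ≈⟨ solve 3 (λ y z x → y :+ z := con false :* x :+ y :+ z) refl (b * P i t) (d * P j t) (v t) ⟩
          0# * v t + b * P i t + d * P j t  ≈⟨ +-congʳ (+-congʳ (*-congʳ a≈0)) ⟨
          a * v t + b * P i t + d * P j t   ≈⟨ h t ⟩
          0#                                ∎)

    affineArc : AffineArc K k
    affineArc = record
      { resp = λ { x≈y (i , eq) → i , λ t → trans (eq t) (x≈y t) }
      ; enumeration = record
          { at = u ; at-∈ = λ i → i , λ _ → refl ; injective = u-injective ; find = id }
      ; arc = K-arc
      ; covers-point = λ x off → spanned 1# x (1≉0 ∘ proj₁) (point x off)
      ; covers-direction = λ x x≢0 unc → spanned 0# x (x≢0 ∘ proj₂) λ i j b d 0≈b+d h →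
          unc (u i) (u j) b (i , λ _ → refl) (j , λ _ → refl) λ t →
            trans (h t) (trans (+-congˡ (*-congʳ (sym (+≈0⇒≈ (sym 0≈b+d))))) (sym (distribˡ _ _ _)))
      }
      where
      at-point : ∀ x i → OffChords K x → ¬ (∀ t → x t ≈ u i t)
      -- Any s outside {0, 1} will do, as (1 + s) x + s x = x.
      at-point x i off eq with avoid₄ 0# 1# 0# 1#
      ... | s , s≉0 , s≉1 , _ = off (u i) (u i) s (i , λ _ → refl) (i , λ _ → refl) s≉0 s≉1 λ t →
              trans (eq t) (solve 2 (λ s x → x := (con true :+ s) :* x :+ s :* x) refl s (u i t))
      point : ∀ x → OffChords K x → ∀ i j b d → 1# ≈ b + d → ¬ (∀ t → x t ≈ b * u i t + d * u j t)
      point x off i j b d 1≈b+d h with d ≟ 0# | d ≟ 1#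
      ... | no d≉0 | no d≉1 = off (u i) (u j) d (i , λ _ → refl) (j , λ _ → refl) d≉0 d≉1 λ t →
              trans (h t) (+-congʳ (*-congʳ (trans (solve 2 (λ b d → b := (b :+ d) :+ d) refl b d) (+-congʳ (sym 1≈b+d)))))
      ... | yes d≈0 | _ = at-point x i off λ t → begin
              x t                          ≈⟨ h t ⟩
              b * u i t + d * u j t        ≈⟨ +-cong (*-congʳ (trans (sym (+-identityʳ b)) (trans (+-congˡ (sym d≈0)) (sym 1≈b+d)))) (*-congʳ d≈0) ⟩
              1# * u i t + 0# * u j t      ≈⟨ solve 2 (λ x y → con true :* x :+ con false :* y := x) refl (u i t) (u j t) ⟩
              u i t                        ∎
      ... | no _ | yes d≈1 = at-point x j off λ t → begin
              x t                          ≈⟨ h t ⟩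
              b * u i t + d * u j t        ≈⟨ +-cong (*-congʳ (trans (solve 2 (λ b d → b := (b :+ d) :+ d) refl b d)
                                                (≈⇒+≈0 (trans (sym 1≈b+d) (sym d≈1))))) (*-congʳ d≈1) ⟩
              0# * u i t + 1# * u j t      ≈⟨ solve 2 (λ x y → con false :* x :+ con true :* y := y) refl (u i t) (u j t) ⟩
              u j t                        ∎

-- Affine normalisation of the arc by counting

triangle : ℕ → ℕ
triangle zero = 0
triangle (suc k) = k ℕ.+ triangle k

-- `triangle k` is the binomial coefficient k over 2, the number of pairs listed by `pairSums`; this
-- form avoids subtraction and division.
triangle-double : ∀ k → triangle k ℕ.+ triangle k ℕ.+ k ≡ k ℕ.* k
triangle-double zero = ≡.refl
triangle-double (suc k) = ≡.trans
  (+-*-Solver.solve 2 (λ k t → (k :+ t) :+ (k :+ t) :+ (con 1 :+ k) := con 1 :+ k :+ k :+ (t :+ t :+ k)) ≡.refl k (triangle k))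
  (≡.trans (≡.cong (suc k ℕ.+ k ℕ.+_) (triangle-double k))
    (+-*-Solver.solve 1 (λ k → con 1 :+ k :+ k :+ k :* k := (con 1 :+ k) :* (con 1 :+ k)) ≡.refl k))
  where open +-*-Solver using (_:+_; _:*_; _:=_; con)

module Normalisation (F : CommutativeRing 0ℓ 0ℓ) (q : ℕ) (ff : IsFiniteField F q) (pow : IsPowerOf2 q) (8<q : 8 < q) where
  open CommutativeRing F hiding (zero)
  open IsFiniteField ff
  open Char2 F q ff pow
  open Levels F q ff pow
  open Coverage F q ff pow 8<q
  open Arcs F q ff pow 8<q
  open import Relation.Binary.Reasoning.Setoid setoid

  pairSums : ∀ {k} → (Fin k → Block) → Fin (triangle k) → Block
  pairSums {suc k} u i = [ (λ j t → u zero t + u (suc j) t) , pairSums (u ∘ suc) ]′ (splitAt k i)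

  pairSums-complete : ∀ {k} (u : Fin k → Block) i j → i ≢ j → ∃ λ m → ∀ t → pairSums u m t ≈ u i t + u j t
  pairSums-complete u zero zero i≢j = contradiction ≡.refl i≢j
  pairSums-complete {suc k} u zero (suc j) _ = j ↑ˡ triangle k ,
    λ t → reflexive (≡.cong (λ s → [ (λ j (t : Fin 2) → u zero t + u (suc j) t) , pairSums (u ∘ suc) ]′ s t)
            (Fin.splitAt-↑ˡ k j (triangle k)))
  pairSums-complete {suc k} u (suc i) zero _ = i ↑ˡ triangle k ,
    λ t → trans (reflexive (≡.cong (λ s → [ (λ j (t : Fin 2) → u zero t + u (suc j) t) , pairSums (u ∘ suc) ]′ s t)
            (Fin.splitAt-↑ˡ k i (triangle k)))) (+-comm _ _)
  pairSums-complete {suc k} u (suc i) (suc j) i≢j with pairSums-complete (u ∘ suc) i j (i≢j ∘ ≡.cong suc)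
  ... | m , eq = k ↑ʳ m ,
    λ t → trans (reflexive (≡.cong (λ s → [ (λ j (t : Fin 2) → u zero t + u (suc j) t) , pairSums (u ∘ suc) ]′ s t)
            (Fin.splitAt-↑ʳ k (triangle k) m))) (eq t)

  -- `no-difference` keeps the points of `Upper` off the chord directions of K × Par; `off-parabola`
  -- prevents lines through all three affine pieces of the odd case.
  record NormalArc (c : Carrier) (k : ℕ) : Set₁ where
    field
      K             : Block → Set
      isAffineArc   : AffineArc K k
      off-parabola  : ∀ u → K u → ¬ OnParabola u
      no-difference : ∀ i p r → K p → K r → ¬ (∀ t → p t + r t ≈ w c i t)

  module AffineMap (a b : Block) (det≉0 : ¬ a 0F * b 1F + a 1F * b 0F ≈ 0#) where
    private
      D = a 0F * b 1F + a 1F * b 0F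

    -- M sends (1,0), (0,1), (1,c) to a, b, a + c b. The inverse is Cramer's rule, without signs in
    -- characteristic 2.
    M M⁻¹ : Block → Block
    M u t = u 0F * a t + u 1F * b t
    M⁻¹ y 0F = inv D * (y 0F * b 1F + y 1F * b 0F)
    M⁻¹ y 1F = inv D * (y 0F * a 1F + y 1F * a 0F)

    M-cong : ∀ {u v} → u ≈₂ v → M u ≈₂ M v
    M-cong eq t = +-cong (*-congʳ (eq 0F)) (*-congʳ (eq 1F))

    M-lin : ∀ e f u v t → M (λ t → e * u t + f * v t) t ≈ e * M u t + f * M v t
    M-lin e f u v t = solve 8 (λ e f u₀ u₁ v₀ v₁ a b → (e :* u₀ :+ f :* v₀) :* a :+ (e :* u₁ :+ f :* v₁) :* b :=
      e :* (u₀ :* a :+ u₁ :* b) :+ f :* (v₀ :* a :+ v₁ :* b)) refl e f (u 0F) (u 1F) (v 0F) (v 1F) (a t) (b t)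

    private
      D-cancel : ∀ x → inv D * (D * x) ≈ x
      D-cancel x = trans (sym (*-assoc _ _ _)) (trans (*-congʳ (trans (*-comm _ _) (invʳ det≉0))) (*-identityˡ x))

    M-M⁻¹ : ∀ y → M (M⁻¹ y) ≈₂ y
    M-M⁻¹ y 0F = trans (solve 7 (λ i y₀ y₁ a₀ a₁ b₀ b₁ →
      i :* (y₀ :* b₁ :+ y₁ :* b₀) :* a₀ :+ i :* (y₀ :* a₁ :+ y₁ :* a₀) :* b₀ := i :* ((a₀ :* b₁ :+ a₁ :* b₀) :* y₀))
      refl (inv D) (y 0F) (y 1F) (a 0F) (a 1F) (b 0F) (b 1F)) (D-cancel _)
    M-M⁻¹ y 1F = trans (solve 7 (λ i y₀ y₁ a₀ a₁ b₀ b₁ →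
      i :* (y₀ :* b₁ :+ y₁ :* b₀) :* a₁ :+ i :* (y₀ :* a₁ :+ y₁ :* a₀) :* b₁ := i :* ((a₀ :* b₁ :+ a₁ :* b₀) :* y₁))
      refl (inv D) (y 0F) (y 1F) (a 0F) (a 1F) (b 0F) (b 1F)) (D-cancel _)

    M⁻¹-M : ∀ u → M⁻¹ (M u) ≈₂ u
    M⁻¹-M u 0F = trans (solve 7 (λ i u₀ u₁ a₀ a₁ b₀ b₁ →
      i :* ((u₀ :* a₀ :+ u₁ :* b₀) :* b₁ :+ (u₀ :* a₁ :+ u₁ :* b₁) :* b₀) := i :* ((a₀ :* b₁ :+ a₁ :* b₀) :* u₀))
      refl (inv D) (u 0F) (u 1F) (a 0F) (a 1F) (b 0F) (b 1F)) (D-cancel _)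
    M⁻¹-M u 1F = trans (solve 7 (λ i u₀ u₁ a₀ a₁ b₀ b₁ →
      i :* ((u₀ :* a₀ :+ u₁ :* b₀) :* a₁ :+ (u₀ :* a₁ :+ u₁ :* b₁) :* a₀) := i :* ((a₀ :* b₁ :+ a₁ :* b₀) :* u₁))
      refl (inv D) (u 0F) (u 1F) (a 0F) (a 1F) (b 0F) (b 1F)) (D-cancel _)

    M⁻¹-cong : ∀ {x y} → x ≈₂ y → M⁻¹ x ≈₂ M⁻¹ y
    M⁻¹-cong eq 0F = *-congˡ (+-cong (*-congʳ (eq 0F)) (*-congʳ (eq 1F)))
    M⁻¹-cong eq 1F = *-congˡ (+-cong (*-congʳ (eq 0F)) (*-congʳ (eq 1F)))

    M-injective : ∀ {u v} → M u ≈₂ M v → u ≈₂ v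
    M-injective {u} {v} eq t = trans (sym (M⁻¹-M u t)) (trans (M⁻¹-cong {M u} {M v} eq t) (M⁻¹-M v t))

    module Translate (z : Block) {K : Block → Set} {k : ℕ} (arc : AffineArc K k) where
      open AffineArc arc using (resp)

      T T⁻¹ : Block → Block
      T u t = M u t + z t
      T⁻¹ y = M⁻¹ (λ t → y t + z t)

      T-T⁻¹ : ∀ y → T (T⁻¹ y) ≈₂ y
      T-T⁻¹ y t = trans (+-congʳ (M-M⁻¹ (λ t → y t + z t) t)) (solve 2 (λ y z → y :+ z :+ z := y) refl (y t) (z t))

      T-injective : ∀ {u v} → T u ≈₂ T v → u ≈₂ v
      T-injective eq = M-injective λ t → +≈0⇒≈ (trans
        (solve 3 (λ x y z → x :+ y := (x :+ z) :+ (y :+ z)) refl _ _ (z t)) (≈⇒+≈0 (eq t)))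

      -- A preimage under T, so a difference w of points of K′ becomes the difference M w of points
      -- of K.
      K′ : Block → Set
      K′ u = K (T u)

      K′-T⁻¹ : ∀ {y} → K y → K′ (T⁻¹ y)
      K′-T⁻¹ {y} = resp (λ t → sym (T-T⁻¹ y t))

      affineArc : AffineArc K′ k
      affineArc = record
        { resp = λ eq → resp (λ t → +-congʳ (M-cong eq t))
        ; enumeration = enum-map T⁻¹ (λ eq → M⁻¹-cong (λ t → +-congʳ (eq t)))
            (λ {x} {y} eq t → trans (sym (T-T⁻¹ x t)) (trans (+-congʳ (M-cong eq t)) (T-T⁻¹ y t)))
            (λ y → K′-T⁻¹)
            (λ u Ku → T u , Ku , T-injective (T-T⁻¹ (T u)))
            (AffineArc.enumeration arc)
        ; arc = λ u v x e f g Ku Kv Kx e≉0 f≉0 g≉0 sum≈0 h → T-injective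
            (AffineArc.arc arc (T u) (T v) (T x) e f g Ku Kv Kx e≉0 f≉0 g≉0 sum≈0 λ t → begin
              e * T u t + f * T v t + g * T x t
                ≈⟨ solve 7 (λ e f g x y v z → e :* (x :+ z) :+ f :* (y :+ z) :+ g :* (v :+ z) :=
                     (e :* x :+ f :* y) :+ g :* v :+ (e :+ f :+ g) :* z) refl e f g (M u t) (M v t) (M x t) (z t) ⟩
              (e * M u t + f * M v t) + g * M x t + (e + f + g) * z t
                ≈⟨ +-cong (+-congʳ (sym (M-lin e f u v t))) (trans (*-congʳ sum≈0) (zeroˡ _)) ⟩
              M (λ t → e * u t + f * v t) t + g * M x t + 0#
                ≈⟨ +-identityʳ _ ⟩
              M (λ t → e * u t + f * v t) t + g * M x t
                ≈⟨ +-congʳ (M-cong (λ t → +≈0⇒≈ (h t)) t) ⟩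
              M (λ t → g * x t) t + g * M x t
                ≈⟨ solve 5 (λ g x y a b → (g :* x) :* a :+ (g :* y) :* b :+ g :* (x :* a :+ y :* b) := con false)
                     refl g (x 0F) (x 1F) (a t) (b t) ⟩
              0# ∎)
        ; covers-point = λ u off → AffineArc.covers-point arc (T u) λ p r s Kp Kr s≉0 s≉1 h →
            off (T⁻¹ p) (T⁻¹ r) s (K′-T⁻¹ Kp) (K′-T⁻¹ Kr) s≉0 s≉1 (T-injective λ t → begin
              T u t
                ≈⟨ h t ⟩
              (1# + s) * p t + s * r t
                ≈⟨ +-cong (*-congˡ (T-T⁻¹ p t)) (*-congˡ (T-T⁻¹ r t)) ⟨
              (1# + s) * T (T⁻¹ p) t + s * T (T⁻¹ r) t
                ≈⟨ solve 4 (λ s x y z → (con true :+ s) :* (x :+ z) :+ s :* (y :+ z) := ((con true :+ s) :* x :+ s :* y) :+ z)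
                     refl s (M (T⁻¹ p) t) (M (T⁻¹ r) t) (z t) ⟩
              ((1# + s) * M (T⁻¹ p) t + s * M (T⁻¹ r) t) + z t
                ≈⟨ +-congʳ (M-lin (1# + s) s (T⁻¹ p) (T⁻¹ r) t) ⟨
              T (λ t → (1# + s) * T⁻¹ p t + s * T⁻¹ r t) t ∎)
        ; covers-direction = λ u u≢0 none → AffineArc.covers-direction arc (M u)
            (λ Mu≈0 → u≢0 (M-injective {u} {λ _ → 0#}
               (λ t → trans (Mu≈0 t) (solve 2 (λ a b → con false := con false :* a :+ con false :* b) refl (a t) (b t)))))
            λ p r e Kp Kr h → none (T⁻¹ p) (T⁻¹ r) e (K′-T⁻¹ Kp) (K′-T⁻¹ Kr) λ t → trans (M-injective {u} {λ t → e * T⁻¹ p t + e * T⁻¹ r t} (λ t → begin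
              M u t
                ≈⟨ h t ⟩
              e * (p t + r t)
                ≈⟨ *-congˡ (+-cong (T-T⁻¹ p t) (T-T⁻¹ r t)) ⟨
              e * (T (T⁻¹ p) t + T (T⁻¹ r) t)
                ≈⟨ solve 4 (λ e x y z → e :* ((x :+ z) :+ (y :+ z)) := e :* x :+ e :* y) refl e (M (T⁻¹ p) t) (M (T⁻¹ r) t) (z t) ⟩
              e * M (T⁻¹ p) t + e * M (T⁻¹ r) t
                ≈⟨ M-lin e e (T⁻¹ p) (T⁻¹ r) t ⟨
              M (λ t → e * T⁻¹ p t + e * T⁻¹ r t) t ∎) t) (sym (distribˡ _ _ _))
        }

      difference : ∀ u v x → (∀ t → u t + v t ≈ x t) → ∀ t → T u t + T v t ≈ M x t
      difference u v x h t = begin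
        T u t + T v t
          ≈⟨ solve 3 (λ x y z → (x :+ z) :+ (y :+ z) := con true :* x :+ con true :* y) refl (M u t) (M v t) (z t) ⟩
        1# * M u t + 1# * M v t                 ≈⟨ M-lin 1# 1# u v t ⟨
        M (λ t → 1# * u t + 1# * v t) t         ≈⟨ M-cong (λ t → trans (+-cong (*-identityˡ _) (*-identityˡ _)) (h t)) t ⟩
        M x t                                   ∎

  module _ (c : Carrier) (c≉0 : ¬ c ≈ 0#) {K : Block → Set} {k : ℕ} (1+k<q : suc k < q) (arc : AffineArc K k) where
    private
      u : Fin k → Block
      u = Enumeration.at (AffineArc.enumeration arc)

      suc-k*q<q*q : suc k ℕ.* q < q ℕ.* q
      suc-k*q<q*q = k*q<q*q 1+k<q

      -- Here k² + q ≤ (k + 1) q < q². The term k² bounds twice the number of pairs, and q bounds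
      -- the other vectors to be avoided.
      k²+q<q² : k ℕ.* k ℕ.+ q < q ℕ.* q
      k²+q<q² = ℕₚ.≤-<-trans (ℕₚ.≤-trans (ℕₚ.+-monoˡ-≤ q (ℕₚ.*-monoʳ-≤ k (ℕₚ.<⇒≤ (ℕₚ.<-trans (ℕₚ.n<1+n k) 1+k<q))))
                  (ℕₚ.≤-reflexive (ℕₚ.+-comm (k ℕ.* q) q))) suc-k*q<q*q

      2t≤k² : triangle k ℕ.+ triangle k ℕ.≤ k ℕ.* k
      2t≤k² = ℕₚ.≤-trans (ℕₚ.m≤m+n _ k) (ℕₚ.≤-reflexive (triangle-double k))

      first-avoid : ∃ λ a → ∀ i → ¬ ((λ _ → 0#) Vector.∷ pairSums u) i ≈₂ a
      first-avoid = avoid-Block (ℕₚ.≤-<-trans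
        (ℕₚ.≤-trans (ℕₚ.+-mono-≤ (ℕₚ.≤-trans (s≤s z≤n) 8<q) (ℕₚ.≤-trans (ℕₚ.m≤m+n _ _) 2t≤k²))
          (ℕₚ.≤-reflexive (ℕₚ.+-comm q (k ℕ.* k)))) k²+q<q²) _

      -- The exclusions say that neither b nor a + c b is a sum of two distinct points of K, and
      -- that b is no multiple of a; they number twice `triangle k` plus q.
      second-avoid : ∀ (a : Block) → ∃ λ (b : Block) → (∀ i → ¬ pairSums u i ≈₂ b) ×
                       (∀ i → ¬ (λ t → inv c * (pairSums u i t + a t)) ≈₂ b) × (∀ e → ¬ (λ t → e * a t) ≈₂ b)
      second-avoid a = proj₁ avoided ,
          (λ i eq → proj₂ avoided (join _ _ (inj₁ i))
             λ t → trans (reflexive (≡.cong (λ s → bad s t) (Fin.splitAt-join n (n ℕ.+ q) (inj₁ i)))) (eq t)) ,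
          (λ i eq → proj₂ avoided (join n _ (inj₂ (join n q (inj₁ i))))
             λ t → trans (reflexive (≡.trans (≡.cong (λ s → bad s t) (Fin.splitAt-join n (n ℕ.+ q) (inj₂ (join n q (inj₁ i)))))
                     (≡.cong (λ s → bad′ s t) (Fin.splitAt-join n q (inj₁ i))))) (eq t)) ,
          (λ e eq → proj₂ avoided (join n _ (inj₂ (join n q (inj₂ (index e)))))
             λ t → trans (reflexive (≡.trans (≡.cong (λ s → bad s t) (Fin.splitAt-join n (n ℕ.+ q) (inj₂ (join n q (inj₂ (index e))))))
                     (≡.cong (λ s → bad′ s t) (Fin.splitAt-join n q (inj₂ (index e)))))) (trans (*-congʳ (enum-index e)) (eq t)))
        where
        n = triangle k
        bad′ : Fin n ⊎ Fin q → Block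
        bad′ = [ (λ i t → inv c * (pairSums u i t + a t)) , (λ i t → enum i * a t) ]
        bad : Fin n ⊎ Fin (n ℕ.+ q) → Block
        bad = [ pairSums u , bad′ ∘ splitAt n ]
        avoided = avoid-Block (ℕₚ.≤-<-trans (ℕₚ.≤-trans (ℕₚ.≤-reflexive (≡.sym (ℕₚ.+-assoc n n q)))
                    (ℕₚ.+-monoˡ-≤ q 2t≤k²)) k²+q<q²) (bad ∘ splitAt n)

      det-≉0 : ∀ a b → ¬ Zero₂ a → (∀ e → ¬ (λ t → e * a t) ≈₂ b) → ¬ a 0F * b 1F + a 1F * b 0F ≈ 0#
      det-≉0 a b a≢0 b∉⟨a⟩ det≈0 with a 0F ≟ 0# | a 1F ≟ 0#
      ... | yes a₀≈0 | yes a₁≈0 = a≢0 λ { 0F → a₀≈0 ; 1F → a₁≈0 }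
      ... | no a₀≉0 | _ = b∉⟨a⟩ (inv (a 0F) * b 0F) λ
              { 0F → trans (*-comm _ _) (trans (sym (*-assoc _ _ _)) (trans (*-congʳ (invʳ a₀≉0)) (*-identityˡ _)))
              ; 1F → sym (trans (isolate a₀≉0 det≈0) (solve 3 (λ i x y → i :* (x :* y) := i :* y :* x) refl _ (a 1F) (b 0F))) }
      ... | yes a₀≈0 | no a₁≉0 = b∉⟨a⟩ (inv (a 1F) * b 1F) λ
              { 0F → sym (trans (isolate a₁≉0 (trans (+-comm _ _) det≈0)) (solve 3 (λ i x y → i :* (x :* y) := i :* y :* x) refl _ (a 0F) (b 1F)))
              ; 1F → trans (*-comm _ _) (trans (sym (*-assoc _ _ _)) (trans (*-congʳ (invʳ a₁≉0)) (*-identityˡ _))) }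

      sums : ∀ p r → K p → K r → (∀ t → p t + r t ≈ 0#) ⊎ ∃ λ m → ∀ t → pairSums u m t ≈ p t + r t
      sums p r Kp Kr with Enumeration.find (AffineArc.enumeration arc) Kp | Enumeration.find (AffineArc.enumeration arc) Kr
      ... | i , ui≈p | j , uj≈r with i Fin.≟ j
      ...   | yes ≡.refl = inj₁ λ t → ≈⇒+≈0 (trans (sym (ui≈p t)) (uj≈r t))
      ...   | no i≢j with pairSums-complete u i j i≢j
      ...     | m , eq = inj₂ (m , λ t → trans (eq t) (+-cong (ui≈p t) (uj≈r t)))

      -- The k q values forbidden for z: M (s, s²) + z equals u i exactly if z = u i + M (s, s²).
      parabola-point : (Block → Block) → Fin k × Fin q → Block
      parabola-point M (i , s) t = u i t + M (block (enum s) (enum s * enum s)) t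

    module _ (a b : Block) (a-avoids : ∀ i → ¬ ((λ _ → 0#) Vector.∷ pairSums u) i ≈₂ a)
             (b-avoids : ∀ i → ¬ pairSums u i ≈₂ b) (b-avoids′ : ∀ i → ¬ (λ t → inv c * (pairSums u i t + a t)) ≈₂ b)
             (b∉⟨a⟩ : ∀ e → ¬ (λ t → e * a t) ≈₂ b) (det≉0 : ¬ a 0F * b 1F + a 1F * b 0F ≈ 0#) where
      open AffineMap a b det≉0

      module _ (z : Block) (z-avoids : ∀ j → ¬ parabola-point M (remQuot q j) ≈₂ z) where
        open Translate z arc

        off-parabola : ∀ x → K′ x → ¬ OnParabola x
        off-parabola x Kx par with Enumeration.find (AffineArc.enumeration arc) Kx
        ... | i , eq = z-avoids (combine i (index (x 0F))) λ t → begin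
            _  ≈⟨ reflexive (≡.cong (λ is → parabola-point M is t) (Fin.remQuot-combine i (index (x 0F)))) ⟩
            u i t + M (block s (s * s)) t
               ≈⟨ +-cong (eq t) (M-cong {block s (s * s)} {x} (λ { 0F → enum-index _ ; 1F → trans (*-cong (enum-index _) (enum-index _)) (sym par) }) t) ⟩
            (M x t + z t) + M x t
               ≈⟨ solve 2 (λ x z → (x :+ z) :+ x := z) refl (M x t) (z t) ⟩
            z t ∎
          where
          s = enum (index (x 0F))

        no-difference : ∀ i p r → K′ p → K′ r → ¬ (∀ t → p t + r t ≈ w c i t)
        no-difference i p r Kp Kr h with sums (T p) (T r) Kp Kr
        no-difference 0F p r Kp Kr h | inj₁ eq = a-avoids zero λ t → trans (sym (eq t)) (trans (difference p r _ h t)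
          (solve 2 (λ a b → con true :* a :+ con false :* b := a) refl (a t) (b t)))
        no-difference 0F p r Kp Kr h | inj₂ (m , eq) = a-avoids (suc m) λ t → trans (eq t) (trans (difference p r _ h t)
          (solve 2 (λ a b → con true :* a :+ con false :* b := a) refl (a t) (b t)))
        -- Equal images would make b vanish, and in the case of (1,c) below a + c b; either way b
        -- would be a multiple of a.
        no-difference 1F p r Kp Kr h | inj₁ eq = b∉⟨a⟩ 0# λ t → trans (zeroˡ _) (trans (sym (eq t)) (trans (difference p r _ h t)
          (solve 2 (λ a b → con false :* a :+ con true :* b := b) refl (a t) (b t))))
        no-difference 1F p r Kp Kr h | inj₂ (m , eq) = b-avoids m λ t → trans (eq t) (trans (difference p r _ h t)
          (solve 2 (λ a b → con false :* a :+ con true :* b := b) refl (a t) (b t)))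
        no-difference 2F p r Kp Kr h | inj₁ eq = b∉⟨a⟩ (inv c) λ t → sym (isolate c≉0 (begin
          c * b t + a t       ≈⟨ solve 3 (λ a b c → c :* b :+ a := con true :* a :+ c :* b) refl (a t) (b t) c ⟩
          M (w c 2F) t        ≈⟨ difference p r _ h t ⟨
          T p t + T r t       ≈⟨ eq t ⟩
          0#                  ∎))
        no-difference 2F p r Kp Kr h | inj₂ (m , eq) = b-avoids′ m λ t → sym (isolate c≉0 (begin
          c * b t + (pairSums u m t + a t)
            ≈⟨ solve 4 (λ a b c s → c :* b :+ (s :+ a) := (con true :* a :+ c :* b) :+ s) refl (a t) (b t) c (pairSums u m t) ⟩
          M (w c 2F) t + pairSums u m t
            ≈⟨ ≈⇒+≈0 (sym (trans (eq t) (difference p r _ h t))) ⟩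
          0# ∎))

        normalArc : NormalArc c k
        normalArc = record
          { K = K′
          ; isAffineArc = affineArc
          ; off-parabola = off-parabola
          ; no-difference = no-difference
          }

    normalise : NormalArc c k
    normalise =
      let a , a-avoids = first-avoid
          b , b-avoids , b-avoids′ , b∉⟨a⟩ = second-avoid a
          det = det-≉0 a b (λ a≈0 → a-avoids zero (λ t → sym (a≈0 t))) b∉⟨a⟩
          z , z-avoids = avoid-Block (k*q<q*q (ℕₚ.<-trans (ℕₚ.n<1+n k) 1+k<q)) _
      in normalArc a b a-avoids b-avoids b-avoids′ b∉⟨a⟩ det z z-avoids

-- Arithmetic of the cardinalities

module Counting where
  open import Data.Nat using (_+_; _*_)
  open +-*-Solver using (solve; _:+_; _:*_; _:=_; con)

  -- With Q = q^(m+1), a further layer has Q vectors over (1,0) and Q - 1 over each of (0,1) and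
  -- (1,c), together 3 Q - 2. The deficits of 2 are collected on the left; the constant 4 fits the
  -- two points of the lowest layer.
  lower-count : ∀ {s n m σ Q} → Q ≡ suc s → n + 2 * suc m ≡ 3 * σ + 4 →
                Q + s + s + n + 2 * suc (suc m) ≡ 3 * (σ + Q) + 4
  lower-count {s} {n} {m} {σ} ≡.refl eq = ≡.trans
    (solve 3 (λ s n m → con 1 :+ s :+ s :+ s :+ n :+ con 2 :* (con 2 :+ m) :=
       (n :+ con 2 :* (con 1 :+ m)) :+ con 3 :* (con 1 :+ s)) ≡.refl s n m)
    (≡.trans (≡.cong (_+ 3 * suc s) eq)
      (solve 2 (λ σ Q → con 3 :* σ :+ con 4 :+ con 3 :* Q := con 3 :* (σ :+ Q) :+ con 4) ≡.refl σ (suc s)))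

  -- The zero tail is missing over all three w, so this layer adds 3 Q - 3; adding 3 to both sides
  -- removes the subtraction.
  upper-count : ∀ {s n m σ Q} → Q ≡ suc s → n + 2 * suc m ≡ 3 * σ + 4 →
                s + s + s + n + suc m * 2 ≡ 3 * (σ + Q) + 1
  upper-count {s} {n} {m} {σ} ≡.refl eq = ℕₚ.+-cancelˡ-≡ 3 _ _ (≡.trans
    (solve 3 (λ s n m → con 3 :+ (s :+ s :+ s :+ n :+ (con 1 :+ m) :* con 2) :=
       (n :+ con 2 :* (con 1 :+ m)) :+ con 3 :* (con 1 :+ s)) ≡.refl s n m)
    (≡.trans (≡.cong (_+ 3 * suc s) eq)
      (solve 2 (λ σ Q → con 3 :* σ :+ con 4 :+ con 3 :* Q := con 3 :+ (con 3 :* (σ :+ Q) :+ con 1)) ≡.refl σ (suc s))))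

  even-count : ∀ {x n m y} → n + m ≡ y + 1 → x + 0 + 0 + n + (2 + m) ≡ x + y + 3
  even-count {x} {n} {m} {y} eq = ≡.trans
    (solve 3 (λ x n m → x :+ con 0 :+ con 0 :+ n :+ (con 2 :+ m) := x :+ (n :+ m) :+ con 2) ≡.refl x n m)
    (≡.trans (≡.cong (λ y → x + y + 2) eq) (solve 2 (λ x y → x :+ (y :+ con 1) :+ con 2 := x :+ y :+ con 3) ≡.refl x y))

  odd-count : ∀ {Q x n m y} → n + m ≡ y + 1 → Q + Q + x + n + (3 + m) ≡ 2 * Q + x + y + 4
  odd-count {Q} {x} {n} {m} {y} eq = ≡.trans
    (solve 4 (λ Q x n m → Q :+ Q :+ x :+ n :+ (con 3 :+ m) := con 2 :* Q :+ x :+ (n :+ m) :+ con 3) ≡.refl Q x n m)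
    (≡.trans (≡.cong (λ y → 2 * Q + x + y + 3) eq)
      (solve 3 (λ Q x y → con 2 :* Q :+ x :+ (y :+ con 1) :+ con 3 := con 2 :* Q :+ x :+ y :+ con 4) ≡.refl Q x y))

-- From block vectors to complete caps; sizes of the pieces

module Construction (F : CommutativeRing 0ℓ 0ℓ) (q : ℕ) (ff : IsFiniteField F q) (pow : IsPowerOf2 q) (8<q : 8 < q) where
  open CommutativeRing F hiding (zero)
  open IsFiniteField ff
  open Char2 F q ff pow
  open Levels F q ff pow
  open Coverage F q ff pow 8<q
  open Arcs F q ff pow 8<q
  open Normalisation F q ff pow 8<q using (NormalArc; module NormalArc; normalise)
  open Projective F
  open Counting
  open import Relation.Binary.Reasoning.Setoid setoid

  V-setoid : ℕ → Setoid 0ℓ 0ℓ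
  V-setoid n = ≋-setoid Block-setoid n

  -- `e` places the N + 1 coordinates into blocks of two, and entries outside its image vanish on C;
  -- for even N the number of coordinates is odd. A doubly negated cover suffices because
  -- completeness is itself a negation.
  cap⇒complete : ∀ {N n d} (C : V d → Set) → Cap C → Enumeration (V-setoid d) C n →
    (e : Fin (suc N) → Fin d × Fin 2) →
    (∀ i t → (∃ λ j → e j ≡ (i , t)) ⊎ (∀ p → C p → p i t ≈ 0#)) →
    (extend : Vect N → V d) → (∀ v j → extend v (proj₁ (e j)) (proj₂ (e j)) ≈ v j) →
    (∀ v → ¬ ¬ Covers C (extend v)) → HasCompleteCap N n
  cap⇒complete {N} {n} {d} C cap E e support extend extend-e covered =
      P , ((nonzero , dep2 , dep3) , complete)
    where
    open Enumeration E
    P : Fin n → Vect N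
    P i j = at i (proj₁ (e j)) (proj₂ (e j))

    independent : ∀ i j → i ≢ j → ∀ a b → (∀ k t → a * at i k t + b * at j k t ≈ 0#) → a ≈ 0# × b ≈ 0#
    independent i j i≢j a b h with a ≟ 0# | b ≟ 0#
    ... | yes a≈0 | yes b≈0 = a≈0 , b≈0
    ... | yes a≈0 | no b≉0 = contradiction
        (λ k t → *-≈0 b≉0 (trans (sym (trans (+-congʳ (trans (*-congʳ a≈0) (zeroˡ _))) (+-identityˡ _))) (h k t)))
        (Cap.nonzero cap (at j) (at-∈ j))
    ... | no a≉0 | yes b≈0 = contradiction
        (λ k t → *-≈0 a≉0 (trans (sym (trans (+-congˡ (trans (*-congʳ b≈0) (zeroˡ _))) (+-identityʳ _))) (h k t)))
        (Cap.nonzero cap (at i) (at-∈ i))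
    -- A relation between two vectors becomes one between three by splitting b = s + (b + s) with
    -- both parts nonzero.
    ... | no a≉0 | no b≉0 with avoid₄ 0# b 0# b
    ...   | s , s≉0 , s≉b , _ = contradiction
        (injective i j (Cap.no-line cap (at i) (at j) (at j) a s (b + s) (at-∈ i) (at-∈ j) (at-∈ j) a≉0 s≉0
          (s≉b ∘ sym ∘ +≈0⇒≈) λ k t → trans (solve 4 (λ x s b y → x :+ s :* y :+ (b :+ s) :* y := x :+ b :* y)
            refl (a * at i k t) s b (at j k t)) (h k t)))
        i≢j

    extend2 : ∀ {a b i j} → (∀ t → a * P i t + b * P j t ≈ 0#) → ∀ k t → a * at i k t + b * at j k t ≈ 0#
    extend2 {a} {b} {i} {j} h k t with support k t
    ... | inj₁ (l , ≡.refl) = h l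
    ... | inj₂ null = trans (+-cong (*-congˡ (null _ (at-∈ i))) (*-congˡ (null _ (at-∈ j))))
            (solve 2 (λ a b → a :* con false :+ b :* con false := con false) refl a b)

    extend3 : ∀ {a b d i j l} → (∀ t → R3 a b d (P i t) (P j t) (P l t)) → Rel a b d (at i) (at j) (at l)
    extend3 {a} {b} {d} {i} {j} {l} h k t with support k t
    ... | inj₁ (m , ≡.refl) = h m
    ... | inj₂ null = trans (+-cong (+-cong (*-congˡ (null _ (at-∈ i))) (*-congˡ (null _ (at-∈ j)))) (*-congˡ (null _ (at-∈ l))))
            (solve 3 (λ a b d → a :* con false :+ b :* con false :+ d :* con false := con false) refl a b d)

    nonzero : ∀ i → ¬ IsZero (P i)
    nonzero i z = Cap.nonzero cap (at i) (at-∈ i) vanish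
      where
      vanish : ∀ k t → at i k t ≈ 0#
      vanish k t with support k t
      ... | inj₁ (m , ≡.refl) = z m
      ... | inj₂ null = null _ (at-∈ i)

    dep2 : ∀ i j → i ≢ j → ¬ Dep2 (P i) (P j)
    dep2 i j i≢j (a , b , ab , h) = ab (independent i j i≢j a b (extend2 {a} {b} {i} {j} h))

    dep3 : ∀ i j l → i ≢ j → j ≢ l → i ≢ l → ¬ Dep3 (P i) (P j) (P l)
    dep3 i j l i≢j j≢l i≢l (a , b , d , abd , h) with a ≟ 0# | b ≟ 0# | d ≟ 0#
    ... | yes a≈0 | _ | _ = dep2 j l j≢l (b , d , (λ (b0 , d0) → abd (a≈0 , b0 , d0)) , λ t →
            trans (sym (+-congʳ (trans (+-congʳ (trans (*-congʳ a≈0) (zeroˡ _))) (+-identityˡ _)))) (h t))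
    ... | no _ | yes b≈0 | _ = dep2 i l i≢l (a , d , (λ (a0 , d0) → abd (a0 , b≈0 , d0)) , λ t →
            trans (sym (+-congʳ (trans (+-congˡ (trans (*-congʳ b≈0) (zeroˡ _))) (+-identityʳ _)))) (h t))
    ... | no _ | no _ | yes d≈0 = dep2 i j i≢j (a , b , (λ (a0 , b0) → abd (a0 , b0 , d≈0)) , λ t →
            trans (sym (trans (+-congˡ (trans (*-congʳ d≈0) (zeroˡ _))) (+-identityʳ _))) (h t))
    ... | no a≉0 | no b≉0 | no d≉0 = i≢j (injective i j
            (Cap.no-line cap (at i) (at j) (at l) a b d (at-∈ i) (at-∈ j) (at-∈ l) a≉0 b≉0 d≉0 (extend3 {a} {b} {d} {i} {j} {l} h)))

    complete : ∀ v → ¬ IsCap N (suc n) (v Vector.∷ P)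
    complete v (_ , no-dep2 , no-dep3) = covered v λ (p , r , a , b , Cp , Cr , eq) →
      let i , at-i = find Cp
          j , at-j = find Cr
          v≈ : ∀ t → v t ≈ a * P i t + b * P j t
          v≈ t = trans (sym (extend-e v t)) (trans (eq (proj₁ (e t)) (proj₂ (e t)))
                   (sym (+-cong (*-congˡ (at-i (proj₁ (e t)) (proj₂ (e t)))) (*-congˡ (at-j (proj₁ (e t)) (proj₂ (e t)))))))
      in collinear i j a b v≈
      where
      collinear : ∀ i j a b → ¬ (∀ t → v t ≈ a * P i t + b * P j t)
      collinear i j a b h with i Fin.≟ j
      ... | yes ≡.refl = no-dep2 zero (suc i) (λ ()) (1# , a + b , 1≉0 ∘ proj₁ , λ t →
              trans (+-cong (*-identityˡ _) (distribʳ _ _ _)) (≈⇒+≈0 (h t)))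
      ... | no i≢j = no-dep3 zero (suc i) (suc j) (λ ()) (i≢j ∘ Fin.suc-injective) (λ ())
              (1# , a , b , 1≉0 ∘ proj₁ , λ t → trans (+-assoc _ _ _) (trans (+-congʳ (*-identityˡ _)) (≈⇒+≈0 (h t))))

  cons-cong : ∀ {n} {u u′ : Block} {v v′ : V n} → u ≈₂ u′ → v ≋ v′ → cons u v ≋ cons u′ v′
  cons-cong u≈ v≈ zero = u≈
  cons-cong u≈ v≈ (suc i) = v≈ i

  cons-η : ∀ {n} (v : V (suc n)) → cons (v zero) (tail v) ≋ v
  cons-η v zero t = refl
  cons-η v (suc i) t = refl

  enum-cons : ∀ {n m k} {K : Block → Set} {A : V n → Set} {D : V (suc n) → Set} →
              (∀ u v → K u → A v → D (cons u v)) → (∀ v → D v → K (v zero) × A (tail v)) →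
              Enumeration Block-setoid K k → Enumeration (V-setoid n) A m → Enumeration (V-setoid (suc n)) D (k ℕ.* m)
  enum-cons to from EK EA = enum-map (λ (u , v) → cons u v)
    (λ (u≈ , v≈) → cons-cong u≈ v≈) (λ eq → eq zero , eq ∘ suc) (λ (u , v) (Ku , Av) → to u v Ku Av)
    (λ v Dv → (v zero , tail v) , from v Dv , cons-η v) (enum-× EK EA)

  enum-parabola : Enumeration Block-setoid OnParabola q
  enum-parabola = enum-map (λ x → block x (x * x))
    (λ { eq 0F → eq ; eq 1F → *-cong eq eq }) (λ eq → eq 0F) (λ _ _ → refl)
    (λ u par → u 0F , tt , λ { 0F → refl ; 1F → sym par }) enum-F

  enum-Par : ∀ n → Enumeration (V-setoid n) Par (q ^ n)
  enum-Par zero = record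
    { at = λ _ () ; at-∈ = λ _ () ; injective = λ { zero zero _ → ≡.refl } ; find = λ _ → zero , λ () }
  enum-Par (suc n) = enum-cons (λ { u v par par′ zero → par ; u v par par′ (suc i) → par′ i })
    (λ v par → par zero , par ∘ suc) enum-parabola (enum-Par n)

  enum-NzPar : ∀ n → ∃ λ s → q ^ n ≡ suc s × Enumeration (V-setoid n) NzPar s
  enum-NzPar n = enum-remove {x₀ = λ _ _ → 0#} (enum-Par n) (λ _ → sym (zeroˡ 0#))

  module _ {n} {c} (c≉0 : ¬ c ≈ 0#) {A : Fin 3 → V n → Set} {S : V n → Set} where
    private
      Under : Block → (V n → Set) → V (suc n) → Set
      Under h B v = v zero ≈₂ h × B (tail v)

      enum-under : ∀ {B m} h → Enumeration (V-setoid n) B m → Enumeration (V-setoid (suc n)) (Under h B) m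
      enum-under h = enum-map (cons h) (cons-cong (λ _ → refl)) (λ eq → eq ∘ suc) (λ v b → (λ _ → refl) , b)
        (λ { v (h≈ , b) → tail v , b , λ { zero t → sym (h≈ t) ; (suc i) t → refl } })

      w≉ : ∀ {i j x y} → i ≢ j → x zero ≈₂ w c i → y zero ≈₂ w c j → ¬ _≋_ {suc n} x y
      w≉ {i} {j} i≢j hx hy eq = 1≉0 (w-independent c≉0 i≢j λ t →
        trans (+-cong (*-identityˡ _) (*-identityˡ _)) (≈⇒+≈0 (trans (sym (hx t)) (trans (eq zero t) (hy t)))))

      w≉0 : ∀ i {x y} → x zero ≈₂ w c i → Zero₂ (y zero) → ¬ _≋_ {suc n} x y
      w≉0 i hx hy eq = 1≉0 (w-nonzero i λ t → trans (*-identityˡ _) (trans (sym (hx t)) (trans (eq zero t) (hy t))))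

    enum-Layer : ∀ {n₀ n₁ n₂ s} → Enumeration (V-setoid n) (A 0F) n₀ → Enumeration (V-setoid n) (A 1F) n₁ →
                 Enumeration (V-setoid n) (A 2F) n₂ → Enumeration (V-setoid n) S s →
                 Enumeration (V-setoid (suc n)) (Layer c A S) (n₀ ℕ.+ n₁ ℕ.+ n₂ ℕ.+ s)
    enum-Layer E₀ E₁ E₂ E = enum-map id id id to from
      (enum-⊎ (λ { (inj₁ (inj₁ (h , _))) (h′ , _) → w≉0 0F h h′
                 ; (inj₁ (inj₂ (h , _))) (h′ , _) → w≉0 1F h h′
                 ; (inj₂ (h , _)) (h′ , _) → w≉0 2F h h′ })
        (enum-⊎ (λ { (inj₁ (h , _)) (h′ , _) → w≉ {0F} {2F} (λ ()) h h′ ; (inj₂ (h , _)) (h′ , _) → w≉ {1F} {2F} (λ ()) h h′ })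
          (enum-⊎ (λ { (h , _) (h′ , _) → w≉ {0F} {1F} (λ ()) h h′ }) (enum-under (w c 0F) E₀) (enum-under (w c 1F) E₁))
          (enum-under (w c 2F) E₂))
        (enum-under (λ _ → 0#) E))
      where
      Parts : V (suc n) → Set
      Parts v = ((Under (w c 0F) (A 0F) v ⊎ Under (w c 1F) (A 1F) v) ⊎ Under (w c 2F) (A 2F) v) ⊎ Under (λ _ → 0#) S v
      to : ∀ v → Parts v → Layer c A S v
      to v (inj₁ (inj₁ (inj₁ (h , a)))) = up 0F h a
      to v (inj₁ (inj₁ (inj₂ (h , a)))) = up 1F h a
      to v (inj₁ (inj₂ (h , a))) = up 2F h a
      to v (inj₂ (h , s)) = down h s
      from : ∀ v → Layer c A S v → ∃ λ x → Parts x × x ≋ v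
      from v (up 0F h a) = v , inj₁ (inj₁ (inj₁ (h , a))) , λ _ _ → refl
      from v (up 1F h a) = v , inj₁ (inj₁ (inj₂ (h , a))) , λ _ _ → refl
      from v (up 2F h a) = v , inj₁ (inj₂ (h , a)) , λ _ _ → refl
      from v (down h s) = v , inj₂ (h , s) , λ _ _ → refl

  -- Assembling the even and the odd cap

  module Caps {k} (c : Carrier) (c≉0 : ¬ c ≈ 0#) (c≉1 : ¬ c ≈ 1#) (c²+c+1≉0 : ¬ c * c + c + 1# ≈ 0#)
              (normalArc : NormalArc c k) where
    open Parameter c c≉0 c≉1 c²+c+1≉0
    open NormalArc normalArc
    open AffineArc isAffineArc

    enum-Lower : ∀ m → ∃ λ n → n ℕ.+ 2 ℕ.* suc m ≡ 3 ℕ.* sumPow q m ℕ.+ 4 × Enumeration (V-setoid (suc m)) (Lower (suc m)) n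
    enum-Lower zero = 2 , ≡.refl ,
      enum-Layer c≉0 (enum-Par 0) (enum-Par 0) (enum-∅ λ _ (_ , v≢0) → v≢0 λ ()) (enum-∅ λ _ ())
    enum-Lower (suc m) with enum-Lower m | enum-NzPar (suc m)
    ... | n , eq , E | s , q^m≡1+s , Nz = q ^ suc m ℕ.+ s ℕ.+ s ℕ.+ n ,
        lower-count {σ = sumPow q m} q^m≡1+s eq ,
        enum-Layer c≉0 (enum-Par (suc m)) Nz Nz E

    enum-Upper : ∀ m → ∃ λ n → n ℕ.+ suc m ℕ.* 2 ≡ 3 ℕ.* sumPow q (suc m) ℕ.+ 1 ×
                 Enumeration (V-setoid (suc (suc m))) (Upper (suc m)) n
    enum-Upper m with enum-Lower m | enum-NzPar (suc m)
    ... | n , eq , E | s , q^m≡1+s , Nz = s ℕ.+ s ℕ.+ s ℕ.+ n ,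
        upper-count {σ = sumPow q m} q^m≡1+s eq ,
        enum-Layer c≉0 Nz Nz Nz E

    KPar : ∀ {m} → V (suc m) → Set
    KPar v = K (v zero) × Par (tail v)

    enum-KPar : ∀ m → Enumeration (V-setoid (suc m)) KPar (k ℕ.* q ^ m)
    enum-KPar m = enum-cons (λ _ _ Ku par → Ku , par) (λ _ → id) enumeration (enum-Par m)

    KPar-affineCap : ∀ {m} → AffineCap (KPar {m})
    KPar-affineCap p r s a b d (Kp , pp) (Kr , pr) (Ks , ps) a≉0 b≉0 d≉0 sum≈0 rel = λ
      { zero → arc (p zero) (r zero) (s zero) a b d Kp Kr Ks a≉0 b≉0 d≉0 sum≈0 (rel zero)
      ; (suc i) → Par-affineCap (tail p) (tail r) (tail s) a b d pp pr ps a≉0 b≉0 d≉0 sum≈0 (rel ∘ suc) i }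

    KPar-direction : ∀ {m} p r s e → KPar p → KPar r → Upper m s → ¬ (∀ j t → s j t ≈ e * (p j t + r j t))
    KPar-direction {m} p r s e (Kp , pp) (Kr , pr) s∈ h =
      let i , eq = Upper-direction m s e (λ j t → p j t + r j t) s∈ (Par-+ (tail p) (tail r) pp pr) h
      in no-difference i (p zero) (r zero) Kp Kr eq

    w-off-parabola : ∀ i u → OnParabola u → ¬ u ≈₂ w c i
    w-off-parabola 0F u par eq = 1≉0 (trans (sym (*-identityˡ 1#)) (trans (*-cong (sym (eq 0F)) (sym (eq 0F))) (trans (sym par) (eq 1F))))
    w-off-parabola 1F u par eq = 1≉0 (trans (sym (eq 1F)) (trans par (trans (*-congʳ (eq 0F)) (zeroˡ _))))
    w-off-parabola 2F u par eq = c≉1 (trans (sym (eq 1F)) (trans par (trans (*-cong (eq 0F) (eq 0F)) (*-identityˡ 1#))))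

    -- The leading block of p + r lies on the parabola, and none of the w does.
    Par-direction : ∀ {m} p r s e → Par p → Par r → Upper m s → ¬ (∀ j t → s j t ≈ e * (p j t + r j t))
    Par-direction {m} p r s e pp pr s∈ h =
      let par = Par-+ p r pp pr
          i , eq = Upper-direction m s e (λ j t → p j t + r j t) s∈ (par ∘ suc) h
      in w-off-parabola i _ (par zero) eq

    module _ {m} {A : Fin 3 → V (suc (suc m)) → Set} (i₀ : Fin 3) (KPar⊆A : ∀ p → KPar p → A i₀ p) where
      private
        C : V (suc (suc (suc m))) → Set
        C = Layer 1# A (Upper (suc m))

        chord : ∀ v → Zero₂ (v zero) → ∀ e p r → KPar p → KPar r →
                (∀ i t → v (suc i) t ≈ e * (p i t + r i t)) → Covers C v
        chord v v₀≈0 e p r Kp Kr h = cons (w 1# i₀) p , cons (w 1# i₀) r , e , e ,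
          up i₀ (λ _ → refl) (KPar⊆A p Kp) , up i₀ (λ _ → refl) (KPar⊆A r Kr) ,
          λ { zero t → trans (v₀≈0 t) (sym (x+x≈0 _)) ; (suc i) t → trans (h i t) (distribˡ _ _ _) }

        zeroes : ∀ {n} → V n
        zeroes _ _ = 0#

        zeroes-par : ∀ {n} → Par (zeroes {n})
        zeroes-par _ = sym (zeroˡ 0#)

      -- Let (ω, x) follow the zero leading block. If both are nonzero, the top layer of `Upper`
      -- covers; (ω, 0) is a chord direction of K; (0, x) is covered by `Lower` or is a multiple of
      -- a vector of `Par`, hence the direction of a chord of K × Par with constant K block.
      cover-infinity : ∀ v → Zero₂ (v zero) → ¬ ¬ Covers C v
      cover-infinity v v₀≈0 ¬cov with Fin.all? (λ t → v (suc zero) t ≟ 0#) | Zero? (tail (tail v))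
      ... | no ω≢0 | no x≢0 = ¬cov (layer-cover-down v v₀≈0 (layer-cover (λ _ _ nz → nz) (tail v) ω≢0 x≢0))
      ... | no ω≢0 | yes x≈0 = covers-direction (v (suc zero)) ω≢0 λ p r e Kp Kr h →
              ¬cov (chord v v₀≈0 e (cons p zeroes) (cons r zeroes) (Kp , zeroes-par) (Kr , zeroes-par) λ
                { zero → h ; (suc i) t → trans (x≈0 i t) (solve 1 (λ e → con false := e :* (con false :+ con false)) refl e) })
      ... | yes ω≈0 | _ with Lower-cover m (tail (tail v))
      ...   | inj₂ cov = ¬cov (layer-cover-down v v₀≈0 (layer-cover-down (tail v) ω≈0 cov))
      -- An arbitrary nonzero direction, used to obtain some point u of K; the double negation
      -- permits this.
      ...   | inj₁ (e , p , par , h) = covers-direction (w c 0F) (λ z → 1≉0 (z 0F)) λ u _ _ Ku _ _ →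
              ¬cov (chord v v₀≈0 e (cons u p) (cons u zeroes) (Ku , par) (Ku , zeroes-par) λ
                { zero t → trans (ω≈0 t) (solve 2 (λ e u → con false := e :* (u :+ u)) refl e (u t))
                ; (suc i) t → trans (h i t) (*-congˡ (sym (+-identityʳ _))) })

      -- After scaling to a = 1, the block of K lies on a chord with weights 1 + s and s. The
      -- remaining blocks decompose with these same weights, since `decompose` accepts any two
      -- distinct nonzero scalars.
      cover-affine : ∀ v a → ¬ a ≈ 0# → (∀ t → v zero t ≈ a * w 1# i₀ t) → ¬ ¬ Covers C v
      cover-affine v a a≉0 h₀ ¬cov = covers-point (x zero) λ p r s Kp Kr s≉0 s≉1 h →
        let open Decomposition (decompose (1# + s) s (s≉1 ∘ sym ∘ +≈0⇒≈) s≉0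
                   (λ eq → 1≉0 (trans (solve 1 (λ s → con true := (con true :+ s) :+ s) refl s) (≈⇒+≈0 eq))) (tail x))
              renaming (p to y; r to y′)
        in ¬cov (cons (w 1# i₀) (cons p y) , cons (w 1# i₀) (cons r y′) , a * (1# + s) , a * s ,
             up i₀ (λ _ → refl) (KPar⊆A _ (Kp , par-p)) , up i₀ (λ _ → refl) (KPar⊆A _ (Kr , par-r)) ,
             λ { zero t → trans (h₀ t) (solve 3 (λ a s w → a :* w := a :* (con true :+ s) :* w :+ a :* s :* w) refl a s (w 1# i₀ t))
               ; (suc zero) t → rescale zero t (h t)
               ; (suc (suc i)) t → rescale (suc i) t (eqn i t) })
        where
        x : V (suc (suc m))
        x i t = inv a * v (suc i) t
        rescale : ∀ i t {s y z} → x i t ≈ (1# + s) * y + s * z → v (suc i) t ≈ a * (1# + s) * y + a * s * z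
        rescale i t {s} {y} {z} eq = begin
          v (suc i) t                    ≈⟨ *-identityˡ _ ⟨
          1# * v (suc i) t               ≈⟨ *-congʳ (invʳ a≉0) ⟨
          a * inv a * v (suc i) t        ≈⟨ *-assoc _ _ _ ⟩
          a * x i t                      ≈⟨ *-congˡ eq ⟩
          a * ((1# + s) * y + s * z)     ≈⟨ solve 4 (λ a s y z → a :* ((con true :+ s) :* y :+ s :* z) :=
                                              a :* (con true :+ s) :* y :+ a :* s :* z) refl a s y z ⟩
          a * (1# + s) * y + a * s * z   ∎

    -- The even case lives in the hyperplane where the second coordinate of the leading block vanishes.
    EvenPart OddPart : ∀ m → Fin 3 → V (suc m) → Set
    EvenPart m 0F = KPar
    EvenPart m 1F _ = ⊥
    EvenPart m 2F _ = ⊥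
    OddPart m 0F = Par
    OddPart m 1F = Par
    OddPart m 2F = KPar

    even-cap : ∀ m → Cap (Layer 1# (EvenPart m) (Upper m))
    even-cap m = layer-cap 1≉0 affine (Upper-cap m) directions (λ _ _ _ _ ())
      where
      affine : ∀ i → AffineCap (EvenPart m i)
      affine 0F = KPar-affineCap
      affine 1F _ _ _ _ _ _ ()
      affine 2F _ _ _ _ _ _ ()
      directions : ∀ i p r s e → EvenPart m i p → EvenPart m i r → Upper m s → ¬ (∀ j t → s j t ≈ e * (p j t + r j t))
      directions 0F = KPar-direction
      directions 1F _ _ _ _ ()
      directions 2F _ _ _ _ ()

    -- For c = 1 a line through all three pieces means p + r = s. Then `Par-+` puts the first block
    -- of s on the parabola, which K avoids.
    odd-cap : ∀ m → Cap (Layer 1# (OddPart m) (Upper m))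
    odd-cap m = layer-cap 1≉0 affine (Upper-cap m) directions transversal
      where
      affine : ∀ i → AffineCap (OddPart m i)
      affine 0F = Par-affineCap
      affine 1F = Par-affineCap
      affine 2F = KPar-affineCap
      directions : ∀ i p r s e → OddPart m i p → OddPart m i r → Upper m s → ¬ (∀ j t → s j t ≈ e * (p j t + r j t))
      directions 0F = Par-direction
      directions 1F = Par-direction
      directions 2F = KPar-direction
      transversal : ∀ p r s → Par p → Par r → KPar s → ¬ (∀ j t → p j t + 1# * r j t + s j t ≈ 0#)
      transversal p r s pp pr (Ks , _) h = off-parabola (s zero) Ks (begin
        s zero 1F                                              ≈⟨ sum 1F ⟨
        p zero 1F + r zero 1F                                  ≈⟨ Par-+ p r pp pr zero ⟩
        (p zero 0F + r zero 0F) * (p zero 0F + r zero 0F)      ≈⟨ *-cong (sum 0F) (sum 0F) ⟩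
        s zero 0F * s zero 0F                                  ∎)
        where
        sum : ∀ t → p zero t + r zero t ≈ s zero t
        sum t = trans (+-congˡ (sym (*-identityˡ _))) (+≈0⇒≈ (h zero t))

    even-cover : ∀ m v → v zero 1F ≈ 0# → ¬ ¬ Covers (Layer 1# (EvenPart (suc m)) (Upper (suc m))) v
    even-cover m v y≈0 with v zero 0F ≟ 0#
    ... | yes x≈0 = cover-infinity 0F (λ _ → id) v λ { 0F → x≈0 ; 1F → y≈0 }
    ... | no x≉0 = cover-affine 0F (λ _ → id) v (v zero 0F) x≉0 λ { 0F → sym (*-identityʳ _) ; 1F → trans y≈0 (sym (zeroʳ _)) }

    -- The leading block (x, y) decides. If x = y ≠ 0, it lies over (1,1), where K × Par covers. If
    -- x and y are distinct and nonzero, one point over (1,0) and one over (0,1) are combined with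
    -- weights x and y. If just one entry is nonzero, say x, two points over the same w get the
    -- weights s and x + s.
    odd-cover : ∀ m v → ¬ ¬ Covers (Layer 1# (OddPart (suc m)) (Upper (suc m))) v
    odd-cover m v with v zero 0F ≟ 0# | v zero 1F ≟ 0# | v zero 0F ≟ v zero 1F
    ... | yes x≈0 | yes y≈0 | _ = cover-infinity 2F (λ _ → id) v λ { 0F → x≈0 ; 1F → y≈0 }
    ... | no x≉0 | _ | yes x≈y = cover-affine 2F (λ _ → id) v (v zero 0F) x≉0
            λ { 0F → sym (*-identityʳ _) ; 1F → trans (sym x≈y) (sym (*-identityʳ _)) }
    ... | yes x≈0 | no y≉0 | yes x≈y = contradiction (trans (sym x≈y) x≈0) y≉0
    ... | no x≉0 | no y≉0 | no x≉y = λ ¬cov → ¬cov (cons (w 1# 0F) p , cons (w 1# 1F) r , v zero 0F , v zero 1F ,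
            up 0F (λ _ → refl) par-p , up 1F (λ _ → refl) par-r ,
            λ { zero 0F → solve 2 (λ x y → x := x :* con true :+ y :* con false) refl (v zero 0F) (v zero 1F)
              ; zero 1F → solve 2 (λ x y → y := x :* con false :+ y :* con true) refl (v zero 0F) (v zero 1F)
              ; (suc i) → eqn i })
      where open Decomposition (decompose (v zero 0F) (v zero 1F) x≉0 y≉0 x≉y (tail v))
    odd-cover m v | no x≉0 | yes y≈0 | no x≉y with avoid₄ 0# (v zero 0F) 0# 0#
    ... | s , s≉0 , s≉x , _ = λ ¬cov → ¬cov (cons (w 1# 0F) p , cons (w 1# 0F) r , s , v zero 0F + s ,
            up 0F (λ _ → refl) par-p , up 0F (λ _ → refl) par-r ,
            λ { zero 0F → solve 2 (λ x s → x := s :* con true :+ (x :+ s) :* con true) refl (v zero 0F) s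
              ; zero 1F → trans y≈0 (solve 2 (λ x s → con false := s :* con false :+ (x :+ s) :* con false) refl (v zero 0F) s)
              ; (suc i) → eqn i })
      where open Decomposition (decompose s (v zero 0F + s) s≉0 (s≉x ∘ sym ∘ +≈0⇒≈)
                   (λ eq → x≉0 (trans (solve 2 (λ x s → x := s :+ (x :+ s)) refl (v zero 0F) s) (≈⇒+≈0 eq))) (tail v))
    odd-cover m v | yes x≈0 | no y≉0 | no x≉y with avoid₄ 0# (v zero 1F) 0# 0#
    ... | s , s≉0 , s≉y , _ = λ ¬cov → ¬cov (cons (w 1# 1F) p , cons (w 1# 1F) r , s , v zero 1F + s ,
            up 1F (λ _ → refl) par-p , up 1F (λ _ → refl) par-r ,
            λ { zero 0F → trans x≈0 (solve 2 (λ x s → con false := s :* con false :+ (x :+ s) :* con false) refl (v zero 1F) s)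
              ; zero 1F → solve 2 (λ x s → x := s :* con true :+ (x :+ s) :* con true) refl (v zero 1F) s
              ; (suc i) → eqn i })
      where open Decomposition (decompose s (v zero 1F + s) s≉0 (s≉y ∘ sym ∘ +≈0⇒≈)
                   (λ eq → y≉0 (trans (solve 2 (λ x s → x := s :+ (x :+ s)) refl (v zero 1F) s) (≈⇒+≈0 eq))) (tail v))

    module _ (m′ : ℕ) where
      private
        m = suc m′

      even : Σ ℕ λ n → (n ℕ.+ (2 ℕ.+ m ℕ.* 2) ≡ k ℕ.* q ^ m ℕ.+ 3 ℕ.* sumPow q m ℕ.+ 3) × HasCompleteCap (2 ℕ.+ m ℕ.* 2) n
      even with enum-Upper m′
      ... | n , eq , E = k ℕ.* q ^ m ℕ.+ 0 ℕ.+ 0 ℕ.+ n ,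
          even-count {k ℕ.* q ^ m} eq ,
          cap⇒complete _ (even-cap m) (enum-Layer 1≉0 (enum-KPar m) (enum-∅ λ _ ()) (enum-∅ λ _ ()) E)
            coordinate support extend extend-coordinate (λ v → even-cover m′ (extend v) refl)
        where
        coordinate : Fin (3 ℕ.+ m ℕ.* 2) → Fin (2 ℕ.+ m) × Fin 2
        coordinate zero = zero , zero
        coordinate (suc j) = let i , t = remQuot {suc m} 2 j in suc i , t
        extend : Vect (2 ℕ.+ m ℕ.* 2) → V (2 ℕ.+ m)
        extend v zero 0F = v zero
        extend v zero 1F = 0#
        extend v (suc i) t = v (suc (combine i t))
        extend-coordinate : ∀ v j → extend v (proj₁ (coordinate j)) (proj₂ (coordinate j)) ≈ v j
        extend-coordinate v zero = refl
        extend-coordinate v (suc j) = reflexive (≡.cong (v ∘ suc) (Fin.combine-remQuot {suc m} 2 j))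
        support : ∀ i t → (∃ λ j → coordinate j ≡ (i , t)) ⊎ (∀ p → Layer 1# (EvenPart m) (Upper m) p → p i t ≈ 0#)
        support zero 0F = inj₁ (zero , ≡.refl)
        support zero 1F = inj₂ λ { p (up 0F h _) → h 1F ; p (up 1F _ ()) ; p (up 2F _ ()) ; p (down h _) → h 1F }
        support (suc i) t = inj₁ (suc (combine i t) , ≡.cong (λ (i , t) → suc i , t) (Fin.remQuot-combine i t))

      odd : Σ ℕ λ n → (n ℕ.+ (3 ℕ.+ m ℕ.* 2) ≡ 2 ℕ.* q ^ suc m ℕ.+ k ℕ.* q ^ m ℕ.+ 3 ℕ.* sumPow q m ℕ.+ 4) ×
            HasCompleteCap (3 ℕ.+ m ℕ.* 2) n
      odd with enum-Upper m′
      ... | n , eq , E = q ^ suc m ℕ.+ q ^ suc m ℕ.+ k ℕ.* q ^ m ℕ.+ n ,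
          odd-count {q ^ suc m} eq ,
          cap⇒complete _ (odd-cap m) (enum-Layer 1≉0 (enum-Par (suc m)) (enum-Par (suc m)) (enum-KPar m) E)
            (remQuot {2 ℕ.+ m} 2) (λ i t → inj₁ (combine i t , Fin.remQuot-combine i t))
            (λ v i t → v (combine i t)) (λ v j → reflexive (≡.cong v (Fin.combine-remQuot {2 ℕ.+ m} 2 j)))
            (λ v → odd-cover m′ _)

  complete-caps : ∀ {k} → k ℕ.+ 5 < q → HasCompleteCap 2 k → ∀ m′ → let m = suc m′ in
    (Σ ℕ λ n → (n ℕ.+ (2 ℕ.+ m ℕ.* 2) ≡ k ℕ.* q ^ m ℕ.+ 3 ℕ.* sumPow q m ℕ.+ 3) × HasCompleteCap (2 ℕ.+ m ℕ.* 2) n) ×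
    (Σ ℕ λ n → (n ℕ.+ (3 ℕ.+ m ℕ.* 2) ≡ 2 ℕ.* q ^ suc m ℕ.+ k ℕ.* q ^ m ℕ.+ 3 ℕ.* sumPow q m ℕ.+ 4) ×
       HasCompleteCap (3 ℕ.+ m ℕ.* 2) n)
  complete-caps {k} k+5<q (P , complete) m′ =
    let c , c≉0 , c≉1 , c²+c+1≉0 = ∃-parameter
        1+k<q = ℕₚ.≤-<-trans (ℕₚ.≤-trans (ℕₚ.≤-reflexive (ℕₚ.+-comm 1 k)) (ℕₚ.+-monoʳ-≤ k (s≤s z≤n))) k+5<q
        l , L≉0 = external-line (ℕₚ.<-trans (ℕₚ.n<1+n k) 1+k<q) P (proj₁ (proj₁ complete))
        arc = normalise c c≉0 1+k<q (Dehomogenise.affineArc P complete l L≉0)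
    in Caps.even c c≉0 c≉1 c²+c+1≉0 arc m′ , Caps.odd c c≉0 c≉1 c²+c+1≉0 arc m′

-- The two parities of N

open import Data.Nat using (_+_; _*_)

even-form : ∀ N → 4 ≤ N → N % 2 ≡ 0 → ∃ λ m → N ≡ 2 + suc m * 2
even-form N 4≤N N%2≡0 with N / 2 | ≡.trans (m≡m%n+[m/n]*n N 2) (≡.cong (_+ N / 2 * 2) N%2≡0)
even-form .0 () _ | 0 | ≡.refl
even-form .2 (s≤s (s≤s ())) _ | 1 | ≡.refl
even-form N _ _ | suc (suc m) | N≡ = m , N≡

odd-form : ∀ N → 4 ≤ N → N % 2 ≡ 1 → ∃ λ m → N ≡ 3 + suc m * 2
odd-form N 4≤N N%2≡1 with N / 2 | ≡.trans (m≡m%n+[m/n]*n N 2) (≡.cong (_+ N / 2 * 2) N%2≡1)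
odd-form .1 (s≤s ()) _ | 0 | ≡.refl
odd-form .3 (s≤s (s≤s (s≤s ()))) _ | 1 | ≡.refl
odd-form N _ _ | suc (suc m) | N≡ = m , N≡

theorem1p1 : (F : CommutativeRing 0ℓ 0ℓ) (q : ℕ) → IsFiniteField F q →
    IsPowerOf2 q → 8 < q →
    (k : ℕ) → k + 5 < q → Projective.HasCompleteCap F 2 k →
    (N : ℕ) → 4 ≤ N →
    (N % 2 ≡ 0 → Σ ℕ λ n → (n + N ≡ k * q ^ ((N ∸ 2) / 2) + 3 * sumPow q ((N ∸ 2) / 2) + 3)
    × Projective.HasCompleteCap F N n)
    × (N % 2 ≡ 1 → Σ ℕ λ n → (n + N ≡ 2 * q ^ ((N ∸ 1) / 2) + k * q ^ ((N ∸ 3) / 2) + 3 * sumPow q ((N ∸ 3) / 2) + 4)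
    × Projective.HasCompleteCap F N n)
theorem1p1 F q ff pow 8<q k k+5<q arc N 4≤N = even , odd
  where
  open Construction F q ff pow 8<q

  even : N % 2 ≡ 0 → Σ ℕ λ n → (n + N ≡ k * q ^ ((N ∸ 2) / 2) + 3 * sumPow q ((N ∸ 2) / 2) + 3)
         × Projective.HasCompleteCap F N n
  even N%2≡0 with even-form N 4≤N N%2≡0
  ... | m , ≡.refl =
    let n , eq , cap = proj₁ (complete-caps k+5<q arc m)
    in n , ≡.trans eq (≡.cong (λ h → k * q ^ h + 3 * sumPow q h + 3) (≡.sym (m*n/n≡m (suc m) 2))) , cap

  odd : N % 2 ≡ 1 → Σ ℕ λ n → (n + N ≡ 2 * q ^ ((N ∸ 1) / 2) + k * q ^ ((N ∸ 3) / 2) + 3 * sumPow q ((N ∸ 3) / 2) + 4)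
        × Projective.HasCompleteCap F N n
  odd N%2≡1 with odd-form N 4≤N N%2≡1
  ... | m , ≡.refl =
    let n , eq , cap = proj₂ (complete-caps k+5<q arc m)
    in n , ≡.trans eq (≡.cong₂ (λ h h′ → 2 * q ^ h′ + k * q ^ h + 3 * sumPow q h + 4)
         (≡.sym (m*n/n≡m (suc m) 2)) (≡.sym (m*n/n≡m (suc (suc m)) 2))) , cap
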